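{- Let $p\ge 7$ be a prime and let $n\ge r\ge 0$ be integers. Then, as a congruence of $p$-integral rational numbers, $$\binom{np}{rp}\Big/\binom{n}{r}\equiv 1+w_p\,n\,r\,(n-r)\,p^3 \pmod{p^5}.$$ Moreover, the congruence $\binom{np}{rp}\big/\binom{n}{r}\equiv 1\pmod{p^4}$ holds for all integers $n\ge r\ge 0$ if and only if $p$ divides the numerator of the Bernoulli number $B_{p-3}$.
   Context: For a prime $p\ge 5$, let $H_1(p-1)=\sum_{k=1}^{p-1}\frac1k$; by Wolstenholme's theorem $H_1(p-1)\equiv 0\pmod{p^2}$, so $H_1(p-1)/p^2$ is a $p$-integral rational number. Define $w_p$ to be the unique integer with $0\le w_p<p^2$ and $w_p\equiv H_1(p-1)/p^2\pmod{p^2}$. Bernoulli numbers $B_k$ are defined by $\frac{x}{e^x-1}=\sum_{k\ge0}B_k\frac{x^k}{k!}$. -}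

module Defs where

open import Data.Nat as ℕ using (ℕ; zero; suc; _≤_; z≤n; s≤s; NonZero; ≢-nonZero; ≢-nonZero⁻¹; _^_)
open import Data.Nat.Properties using (m+n≡0⇒m≡0; m^n≢0)
open import Data.Nat.Combinatorics using (_C_; nCk≡nC[n∸k]; nCn≡1; nCk+nC[k+1]≡[n+1]C[k+1])
open import Data.Nat.Divisibility using (_∣_)
open import Data.Integer as ℤ using (ℤ; +_)
open import Data.Rational using (ℚ; _/_; _+_; _-_; _*_; -_; 0ℚ; 1ℚ; ↥_; ↧ₙ_)
open import Data.List using (List; []; _∷_; zipWith; downFrom; foldr)
open import Data.Product using (Σ; _×_)
open import Relation.Nullary using (¬_)
open import Relation.Binary.PropositionalEquality using (_≡_; refl; trans; sym; subst; cong)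

ℕ→ℚ : ℕ → ℚ
ℕ→ℚ n = (+ n) / 1

ℤ→ℚ : ℤ → ℚ
ℤ→ℚ z = z / 1

IsPIntegral : ℕ → ℚ → Set
IsPIntegral p z = ¬ (p ∣ ↧ₙ z)

CongModPow : (p k : ℕ) → ℚ → ℚ → Set
CongModPow p k x y = Σ ℚ (λ z → IsPIntegral p z × (x - y ≡ ℕ→ℚ (p ^ k) * z))

nCk≢0 : ∀ n k → k ≤ n → NonZero (n C k)
nCk≢0 n zero _ = subst NonZero (sym (trans (nCk≡nC[n∸k] (z≤n {n})) (nCn≡1 n))) _
nCk≢0 (suc n) (suc k) (s≤s k≤n) =
  ≢-nonZero (λ eq → ≢-nonZero⁻¹ (n C k) {{nCk≢0 n k k≤n}}
    (m+n≡0⇒m≡0 (n C k) (trans (nCk+nC[k+1]≡[n+1]C[k+1] n k) eq)))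

binomRatio : (p n r : ℕ) → r ≤ n → ℚ
binomRatio p n r r≤n = (+ ((n ℕ.* p) C (r ℕ.* p))) / (n C r)
  where instance _ = nCk≢0 n r r≤n

harmonic : ℕ → ℚ
harmonic zero    = 0ℚ
harmonic (suc m) = harmonic m + (+ 1) / suc m

harmonicOverSq : (p : ℕ) → .{{NonZero p}} → ℚ
harmonicOverSq p = harmonic (p ℕ.∸ 1) * ((+ 1) / (p ^ 2))
  where instance _ = m^n≢0 p 2

-- Bernoulli numbers  (x/(e^x-1) convention, B_1 = -1/2), via the
-- standard recurrence  Σ_{j=0}^{m} binom(m+1, j) B_j = 0  (m ≥ 1), B_0 = 1.

sumℚ : List ℚ → ℚ
sumℚ = foldr _+_ 0ℚ

-- bernoulliList m = [B_m, B_{m-1}, …, B_0]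
bernoulliList : ℕ → List ℚ
bernoulliList zero    = 1ℚ ∷ []
bernoulliList (suc m) = next ∷ prev
  where
  prev : List ℚ
  prev = bernoulliList m
  next : ℚ
  next = - (((+ 1) / suc (suc m)) *
            sumℚ (zipWith (λ j b → ℕ→ℚ (suc (suc m) C j) * b) (downFrom (suc m)) prev))

bernoulli : ℕ → ℚ
bernoulli m with bernoulliList m
... | b ∷ _ = b
... | []    = 0ℚ

{-# OPTIONS --safe #-}

-- Write p = q + 1, xⱼ = j + 1 and tⱼ = 1/xⱼ for j < q, H = Σ tⱼ, and P(m) = ∏ⱼ (mp + xⱼ).
-- Cancelling the multiples of p in the factorials gives
--   C(np,rp) / C(n,r) = Q(n) / (Q(r) Q(n-r)),  Q(n) = ∏_{m<n} P(m).
-- Pairing j with q - 1 - j, P(m)² = P(0)² ∏ⱼ (1 + m(m+1)p² sⱼ) with sⱼ = 1/(xⱼ(p - xⱼ)), where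
-- p Σ sⱼ = 2H; as p divides Σ sⱼ and Σ sⱼ², this yields P(m) ≡ P(0)(1 + m(m+1)pH) mod p⁵, and the
-- first claim follows from Σ_{m<n} m(m+1) = (n³ - n)/3.
--
-- For the second claim one needs p⁴ ∣ pH ⇔ p ∣ B_{p-3}.  The recurrences for power sums and
-- Bernoulli numbers give Σ xⱼⁱ ≡ p Bᵢ mod p² for i ≤ p - 2.  Newton's identities, applied to x and
-- to t (whose elementary symmetric functions are those of x in reverse order, up to the unit ∏ xⱼ),
-- then link B_{p-3} to Σ tⱼ² modulo p², and Σ tⱼ² ≡ - Σ sⱼ mod p².

module Submission where

open import Defs
open Defs using () renaming (ℕ→ℚ to ι)
open import Data.Nat using (ℕ; _≤_; _*_; _∸_; _^_)
open import Data.Nat as ℕ using (zero; suc; _<_; _!; s≤s; z≤n; NonZero)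
open import Data.Nat.Combinatorics using (_C_; nCn≡1; nC1≡n; nCk≡nC[n∸k]; nCk+nC[k+1]≡[n+1]C[k+1]; k>n⇒nCk≡0; nCk≡n!/k![n-k]!; k![n∸k]!∣n!)
open import Data.Nat.Coprimality as Coprimality using (Coprime; coprime-divisor)
open import Data.Nat.Divisibility using (_∣_)
open import Data.Nat.Divisibility as ∣ using (_∤_; divides)
open import Data.Nat.DivMod using (m/n*n≡m)
open import Data.Nat.Induction using (<-rec)
open import Data.Nat.Primality using (Prime; prime⇒nonZero; euclidsLemma; ¬prime[1])
import Data.Nat.Properties as ℕₚ
open ℕₚ using (_!*_!≢0)
open import Data.Integer as ℤ using (ℤ; +_; ∣_∣)
import Data.Integer.Divisibility.Signed as ℤ∣
import Data.Integer.Properties as ℤₚ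
open import Data.List using (downFrom; zipWith)
open import Data.Product using (Σ; _×_; _,_; proj₁; proj₂)
open import Data.Rational using (ℚ; 1ℚ; _+_; ↥_) renaming (_*_ to _*ℚ_)
open import Data.Rational using (mkℚ; 0ℚ; _/_; _-_; -_; ↧ₙ_; toℚᵘ) renaming (_*_ to _·_)
import Data.Rational.Properties as ℚₚ
open import Data.Rational.Unnormalised as ℚᵘ using (mkℚᵘ; *≡*)
import Data.Rational.Unnormalised.Properties as ℚᵘₚ
open import Data.Sum using (inj₁; inj₂)
open import Function.Bundles using (_⇔_; mk⇔)
open import Level using (0ℓ)
open import Relation.Binary.PropositionalEquality using (_≡_; _≢_; refl; sym; trans; cong; cong₂; subst; module ≡-Reasoning)
open import Relation.Nullary using (contradiction)
open import Relation.Nullary.Decidable using (dec⇒maybe)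
open import Tactic.RingSolver using (solve-∀)
open import Tactic.RingSolver.Core.AlmostCommutativeRing using (AlmostCommutativeRing; fromCommutativeRing)

-- For a single term, `tⱼ² ≡ xⱼ^(p-3)` holds in general only modulo `p`, whereas the second claim
-- compares the two power sums modulo `p²`. Elementary symmetric functions supply the missing power:
-- those of index between `1` and `p - 2`, and the power sums of the same orders, are divisible by
-- `p`, so every product in Newton's identity vanishes modulo `p²` and only the linear relation
-- `k σₖ + Sₖ ≡ 0` remains. The block products are squared because a single factor `mp + xⱼ`
-- deviates from `xⱼ` to first order in `p`, while a pair deviates only to second order. The square
-- root is undone by factoring a difference of squares whose other factor is a unit. The bound on
-- `p` comes from `∑ tⱼ⁴ ≡ 0` modulo `p`, which is used with `4 < p - 1`.

ring : AlmostCommutativeRing 0ℓ 0ℓ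
ring = fromCommutativeRing ℚₚ.+-*-commutativeRing λ x → dec⇒maybe (0ℚ ℚₚ.≟ x)

-- Integers and fractions in lowest terms inside `ℚ`.

/-homo-· : ∀ a b c d .{{_ : NonZero b}} .{{_ : NonZero d}} .{{_ : NonZero (b ℕ.* d)}} →
           (a / b) · (c / d) ≡ (a ℤ.* c) / (b ℕ.* d)
/-homo-· a (suc b) c (suc d) = ℚₚ.toℚᵘ-injective (begin
  toℚᵘ ((a / suc b) · (c / suc d))               ≈⟨ ℚₚ.toℚᵘ-homo-* (a / suc b) (c / suc d) ⟩
  toℚᵘ (a / suc b) ℚᵘ.* toℚᵘ (c / suc d)         ≈⟨ ℚᵘₚ.*-cong (ℚₚ.toℚᵘ-fromℚᵘ (mkℚᵘ a b)) (ℚₚ.toℚᵘ-fromℚᵘ (mkℚᵘ c d)) ⟩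
  mkℚᵘ a b ℚᵘ.* mkℚᵘ c d                         ≈⟨ ℚᵘₚ.≃-sym (ℚₚ.toℚᵘ-fromℚᵘ (mkℚᵘ a b ℚᵘ.* mkℚᵘ c d)) ⟩
  toℚᵘ ((a ℤ.* c) / (suc b ℕ.* suc d))           ∎)
  where open ℚᵘₚ.≃-Reasoning

ℤ→ℚ-homo-+ : ∀ a b → ℤ→ℚ (a ℤ.+ b) ≡ ℤ→ℚ a + ℤ→ℚ b
ℤ→ℚ-homo-+ a b = ℚₚ.toℚᵘ-injective (begin
  toℚᵘ (ℤ→ℚ (a ℤ.+ b))                 ≈⟨ ℚₚ.toℚᵘ-fromℚᵘ (mkℚᵘ (a ℤ.+ b) 0) ⟩
  mkℚᵘ (a ℤ.+ b) 0                     ≈⟨ *≡* (cong (ℤ._* (+ 1)) (sym (cong₂ ℤ._+_ (ℤₚ.*-identityʳ a) (ℤₚ.*-identityʳ b)))) ⟩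
  mkℚᵘ a 0 ℚᵘ.+ mkℚᵘ b 0               ≈⟨ ℚᵘₚ.+-cong (ℚᵘₚ.≃-sym (ℚₚ.toℚᵘ-fromℚᵘ (mkℚᵘ a 0))) (ℚᵘₚ.≃-sym (ℚₚ.toℚᵘ-fromℚᵘ (mkℚᵘ b 0))) ⟩
  toℚᵘ (ℤ→ℚ a) ℚᵘ.+ toℚᵘ (ℤ→ℚ b)       ≈⟨ ℚᵘₚ.≃-sym (ℚₚ.toℚᵘ-homo-+ (ℤ→ℚ a) (ℤ→ℚ b)) ⟩
  toℚᵘ (ℤ→ℚ a + ℤ→ℚ b)                 ∎)
  where open ℚᵘₚ.≃-Reasoning

open ≡-Reasoning

ℤ→ℚ-homo-· : ∀ a b → ℤ→ℚ (a ℤ.* b) ≡ ℤ→ℚ a · ℤ→ℚ b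
ℤ→ℚ-homo-· a b = sym (/-homo-· a 1 b 1)

ι-+ : ∀ m n → ι (m ℕ.+ n) ≡ ι m + ι n
ι-+ m n = ℤ→ℚ-homo-+ (+ m) (+ n)

ι-· : ∀ m n → ι (m ℕ.* n) ≡ ι m · ι n
ι-· m n = trans (cong ℤ→ℚ (ℤₚ.pos-* m n)) (ℤ→ℚ-homo-· (+ m) (+ n))

ι-suc : ∀ n → ι (suc n) ≡ 1ℚ + ι n
ι-suc = ι-+ 1

/-·-cancel : ∀ a d .{{_ : NonZero d}} → (a / d) · ι d ≡ ℤ→ℚ a
/-·-cancel a d@(suc d-1) = trans (/-homo-· a d (+ d) 1)
  (ℚₚ.fromℚᵘ-cong {mkℚᵘ (a ℤ.* (+ d)) (d-1 ℕ.* 1)} {mkℚᵘ a 0}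
    (*≡* (trans (ℤₚ.*-identityʳ (a ℤ.* (+ d))) (cong (λ e → a ℤ.* (+ e)) (sym (ℕₚ.*-identityʳ d))))))

recip : ∀ d .{{_ : NonZero d}} → ι d · ((+ 1) / d) ≡ 1ℚ
recip d = trans (ℚₚ.*-comm (ι d) ((+ 1) / d)) (/-·-cancel (+ 1) d)

ι-cancel : ∀ n .{{_ : NonZero n}} {a b} → ι n · a ≡ ι n · b → a ≡ b
ι-cancel n {a} {b} na≡nb = begin
  a                          ≡⟨ unscale a ⟩
  (+ 1) / n · (ι n · a)      ≡⟨ cong ((+ 1) / n ·_) na≡nb ⟩
  (+ 1) / n · (ι n · b)      ≡⟨ sym (unscale b) ⟩
  b                          ∎
  where
  regroup : ∀ x y z → x · (y · z) ≡ y · x · z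
  regroup = solve-∀ ring
  unscale : ∀ x → x ≡ (+ 1) / n · (ι n · x)
  unscale x = sym (trans (regroup ((+ 1) / n) (ι n) x) (trans (cong (_· x) (recip n)) (ℚₚ.*-identityˡ x)))

numerator/denominator : ∀ z → z · ι (↧ₙ z) ≡ ℤ→ℚ (↥ z)
numerator/denominator z = trans (cong (_· ι (↧ₙ z)) (sym (ℚₚ.↥p/↧p≡p z))) (/-·-cancel (↥ z) (↧ₙ z))

-- `_/_` reduces to lowest terms, which hides numerators; `/-injective-≃` passes to unnormalised
-- fractions, whose equality is cross-multiplication.
cross-multiply : ∀ z d a → z · ι d ≡ ℤ→ℚ a → ↥ z ℤ.* (+ d) ≡ a ℤ.* (+ ↧ₙ z)
cross-multiply z d a z·d≡a = begin
  ↥ z ℤ.* (+ d)               ≡⟨ sym (ℤₚ.*-identityʳ _) ⟩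
  ↥ z ℤ.* (+ d) ℤ.* (+ 1)     ≡⟨ ℚᵘₚ.drop-*≡* (ℚₚ./-injective-≃ (mkℚᵘ (↥ z ℤ.* (+ d)) (ℕ.pred (↧ₙ z ℕ.* 1))) (mkℚᵘ a 0) eq) ⟩
  a ℤ.* (+ (↧ₙ z ℕ.* 1))      ≡⟨ cong (λ e → a ℤ.* (+ e)) (ℕₚ.*-identityʳ (↧ₙ z)) ⟩
  a ℤ.* (+ ↧ₙ z)              ∎
  where
  eq : (↥ z ℤ.* (+ d)) / (↧ₙ z ℕ.* 1) ≡ a / 1
  eq = trans (sym (/-homo-· (↥ z) (↧ₙ z) (+ d) 1)) (trans (cong (_· ι d) (ℚₚ.↥p/↧p≡p z)) z·d≡a)

cross-multiply-ℕ : ∀ z d a → z · ι d ≡ ℤ→ℚ a → ∣ ↥ z ∣ ℕ.* d ≡ ∣ a ∣ ℕ.* ↧ₙ z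
cross-multiply-ℕ z d a eq = trans (sym (ℤₚ.abs-* (↥ z) (+ d)))
  (trans (cong ∣_∣ (cross-multiply z d a eq)) (ℤₚ.abs-* a (+ ↧ₙ z)))

coprime-↥↧ : ∀ z → Coprime ∣ ↥ z ∣ (↧ₙ z)
coprime-↥↧ (mkℚ n d c) {i} = Coprimality.recompute c {i}

-- The ring of `p`-integral rationals and its ideals generated by powers of `p`.

module PAdic (p : ℕ) (pp : Prime p) where

  private instance
    p≢0 : NonZero p
    p≢0 = prime⇒nonZero pp

  ∤-* : ∀ {m n} → p ∤ m → p ∤ n → p ∤ m ℕ.* n
  ∤-* {m} {n} p∤m p∤n p∣mn with euclidsLemma m n pp p∣mn
  ... | inj₁ p∣m = p∤m p∣m
  ... | inj₂ p∣n = p∤n p∣n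

  ∤⇒NonZero : ∀ {n} → p ∤ n → NonZero n
  ∤⇒NonZero p∤n = ℕ.≢-nonZero λ { refl → p∤n (p ∣.∣0) }

  -- The reduced denominator is coprime to the numerator, so it divides every other denominator `d`
  -- of `z`. Thus any one representation with `d` prime to `p` proves integrality.
  fraction-integral : ∀ z d a → p ∤ d → z · ι d ≡ ℤ→ℚ a → IsPIntegral p z
  fraction-integral z d a p∤d eq p∣↧z = p∤d (∣.∣-trans p∣↧z
    (coprime-divisor (Coprimality.sym (coprime-↥↧ z)) (divides ∣ a ∣ (cross-multiply-ℕ z d a eq))))

  infix 4 _∈p^_

  -- Congruences are handled as memberships `x - y ∈p^ k`, so that they combine by ideal arithmetic;
  -- `k = 0` expresses `p`-integrality. The content is that of `CongModPow`, but as a record it lets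
  -- `x` and `k` be inferred.
  record _∈p^_ (x : ℚ) (k : ℕ) : Set where
    constructor multiple
    field
      quotient          : ℚ
      quotient-integral : IsPIntegral p quotient
      factorisation     : x ≡ ι (p ^ k) · quotient

  ∈p^-resp : ∀ {k x y} → x ≡ y → x ∈p^ k → y ∈p^ k
  ∈p^-resp {k} = subst (_∈p^ k)

  integral-+ : ∀ x y → IsPIntegral p x → IsPIntegral p y → IsPIntegral p (x + y)
  integral-+ x y p∤x p∤y = fraction-integral (x + y) (↧ₙ x ℕ.* ↧ₙ y)
    (↥ x ℤ.* (+ ↧ₙ y) ℤ.+ ↥ y ℤ.* (+ ↧ₙ x)) (∤-* p∤x p∤y) (begin
      (x + y) · ι (↧ₙ x ℕ.* ↧ₙ y)                                 ≡⟨ cong ((x + y) ·_) (ι-· (↧ₙ x) (↧ₙ y)) ⟩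
      (x + y) · (ι (↧ₙ x) · ι (↧ₙ y))                             ≡⟨ expand x y (ι (↧ₙ x)) (ι (↧ₙ y)) ⟩
      x · ι (↧ₙ x) · ι (↧ₙ y) + y · ι (↧ₙ y) · ι (↧ₙ x)           ≡⟨ cong₂ (λ u v → u · ι (↧ₙ y) + v · ι (↧ₙ x)) (numerator/denominator x) (numerator/denominator y) ⟩
      ℤ→ℚ (↥ x) · ι (↧ₙ y) + ℤ→ℚ (↥ y) · ι (↧ₙ x)                 ≡⟨ sym (cong₂ _+_ (ℤ→ℚ-homo-· (↥ x) (+ ↧ₙ y)) (ℤ→ℚ-homo-· (↥ y) (+ ↧ₙ x))) ⟩
      ℤ→ℚ (↥ x ℤ.* (+ ↧ₙ y)) + ℤ→ℚ (↥ y ℤ.* (+ ↧ₙ x))             ≡⟨ sym (ℤ→ℚ-homo-+ (↥ x ℤ.* (+ ↧ₙ y)) (↥ y ℤ.* (+ ↧ₙ x))) ⟩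
      ℤ→ℚ (↥ x ℤ.* (+ ↧ₙ y) ℤ.+ ↥ y ℤ.* (+ ↧ₙ x))                 ∎)
    where
    expand : ∀ x y d e → (x + y) · (d · e) ≡ x · d · e + y · e · d
    expand = solve-∀ ring

  integral-· : ∀ x y → IsPIntegral p x → IsPIntegral p y → IsPIntegral p (x · y)
  integral-· x y p∤x p∤y = fraction-integral (x · y) (↧ₙ x ℕ.* ↧ₙ y) (↥ x ℤ.* ↥ y) (∤-* p∤x p∤y) (begin
      x · y · ι (↧ₙ x ℕ.* ↧ₙ y)            ≡⟨ cong (x · y ·_) (ι-· (↧ₙ x) (↧ₙ y)) ⟩
      x · y · (ι (↧ₙ x) · ι (↧ₙ y))        ≡⟨ regroup x y (ι (↧ₙ x)) (ι (↧ₙ y)) ⟩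
      x · ι (↧ₙ x) · (y · ι (↧ₙ y))        ≡⟨ cong₂ _·_ (numerator/denominator x) (numerator/denominator y) ⟩
      ℤ→ℚ (↥ x) · ℤ→ℚ (↥ y)                ≡⟨ sym (ℤ→ℚ-homo-· (↥ x) (↥ y)) ⟩
      ℤ→ℚ (↥ x ℤ.* ↥ y)                    ∎)
    where
    regroup : ∀ x y d e → x · y · (d · e) ≡ x · d · (y · e)
    regroup = solve-∀ ring

  p∤1 : p ∤ 1
  p∤1 p∣1 = Prime⇒≢1 (∣.∣1⇒≡1 p∣1)
    where
    Prime⇒≢1 : p ≢ 1
    Prime⇒≢1 refl = contradiction pp ¬prime[1]

  integral-ℤ : ∀ a → IsPIntegral p (ℤ→ℚ a)
  integral-ℤ a = fraction-integral (ℤ→ℚ a) 1 a p∤1 (ℚₚ.*-identityʳ (ℤ→ℚ a))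

  integral-recip : ∀ {d} .{{_ : NonZero d}} → p ∤ d → IsPIntegral p ((+ 1) / d)
  integral-recip {d} p∤d = fraction-integral ((+ 1) / d) d (+ 1) p∤d (/-·-cancel (+ 1) d)

  ∈p^-+ : ∀ {k x y} → x ∈p^ k → y ∈p^ k → x + y ∈p^ k
  ∈p^-+ {k} (multiple u iu refl) (multiple v iv refl) =
    multiple (u + v) (integral-+ u v iu iv) (sym (ℚₚ.*-distribˡ-+ (ι (p ^ k)) u v))

  ∈p^-· : ∀ {j k x y} → x ∈p^ j → y ∈p^ k → x · y ∈p^ (j ℕ.+ k)
  ∈p^-· {j} {k} (multiple u iu refl) (multiple v iv refl) = multiple (u · v) (integral-· u v iu iv) (begin
      ι (p ^ j) · u · (ι (p ^ k) · v)      ≡⟨ regroup (ι (p ^ j)) u (ι (p ^ k)) v ⟩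
      ι (p ^ j) · ι (p ^ k) · (u · v)      ≡⟨ cong (_· (u · v)) (sym (ι-· (p ^ j) (p ^ k))) ⟩
      ι (p ^ j ℕ.* p ^ k) · (u · v)        ≡⟨ cong (λ e → ι e · (u · v)) (sym (ℕₚ.^-distribˡ-+-* p j k)) ⟩
      ι (p ^ (j ℕ.+ k)) · (u · v)          ∎)
    where
    regroup : ∀ x y d e → x · y · (d · e) ≡ x · d · (y · e)
    regroup = solve-∀ ring

  integral⇒∈p^0 : ∀ {x} → IsPIntegral p x → x ∈p^ 0
  integral⇒∈p^0 {x} ix = multiple x ix (sym (ℚₚ.*-identityˡ x))

  ∈p^0⇒integral : ∀ {x} → x ∈p^ 0 → IsPIntegral p x
  ∈p^0⇒integral (multiple z iz refl) = subst (IsPIntegral p) (sym (ℚₚ.*-identityˡ z)) iz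

  ℤ∈p^0 : ∀ a → ℤ→ℚ a ∈p^ 0
  ℤ∈p^0 a = integral⇒∈p^0 (integral-ℤ a)

  ι∈p^0 : ∀ n → ι n ∈p^ 0
  ι∈p^0 n = ℤ∈p^0 (+ n)

  p^∈p^ : ∀ k → ι (p ^ k) ∈p^ k
  p^∈p^ k = multiple 1ℚ (integral-ℤ (+ 1)) (sym (ℚₚ.*-identityʳ (ι (p ^ k))))

  0∈p^ : ∀ k → 0ℚ ∈p^ k
  0∈p^ k = multiple 0ℚ (integral-ℤ (+ 0)) (sym (ℚₚ.*-zeroʳ (ι (p ^ k))))

  ∈p^-neg : ∀ {k x} → x ∈p^ k → - x ∈p^ k
  ∈p^-neg {k} {x} x∈ = ∈p^-resp (neg-one x) (∈p^-· (ℤ∈p^0 (ℤ.- (+ 1))) x∈)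
    where
    neg-one : ∀ x → (- 1ℚ) · x ≡ - x
    neg-one = solve-∀ ring

  ∈p^-- : ∀ {k x y} → x ∈p^ k → y ∈p^ k → x - y ∈p^ k
  ∈p^-- x∈ y∈ = ∈p^-+ x∈ (∈p^-neg y∈)

  ∈p^-drop : ∀ j {k x} → x ∈p^ (j ℕ.+ k) → x ∈p^ k
  ∈p^-drop j {k} (multiple z iz refl) =
    multiple (ι (p ^ j) · z) (integral-· (ι (p ^ j)) z (integral-ℤ (+ (p ^ j))) iz) (begin
      ι (p ^ (j ℕ.+ k)) · z            ≡⟨ cong (λ e → ι e · z) (ℕₚ.^-distribˡ-+-* p j k) ⟩
      ι (p ^ j ℕ.* p ^ k) · z          ≡⟨ cong (_· z) (ι-· (p ^ j) (p ^ k)) ⟩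
      ι (p ^ j) · ι (p ^ k) · z        ≡⟨ regroup (ι (p ^ j)) (ι (p ^ k)) z ⟩
      ι (p ^ k) · (ι (p ^ j) · z)      ∎)
    where
    regroup : ∀ x y z → x · y · z ≡ y · (x · z)
    regroup = solve-∀ ring

  record Unit (u : ℚ) : Set where
    constructor unit
    field
      inverse          : ℚ
      isInverse        : u · inverse ≡ 1ℚ
      inverse-integral : inverse ∈p^ 0

  cancel-unit : ∀ {k u} → Unit u → ∀ {x} → u · x ∈p^ k → x ∈p^ k
  cancel-unit {k} {u} (unit v uv≡1 v∈) {x} ux∈ = ∈p^-resp (begin
      v · (u · x)   ≡⟨ regroup v u x ⟩
      u · v · x     ≡⟨ cong (_· x) uv≡1 ⟩
      1ℚ · x        ≡⟨ ℚₚ.*-identityˡ x ⟩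
      x             ∎) (∈p^-· v∈ ux∈)
    where
    regroup : ∀ x y z → x · (y · z) ≡ y · x · z
    regroup = solve-∀ ring

  unit-ι : ∀ n → p ∤ n → Unit (ι n)
  unit-ι n p∤n = unit ((+ 1) / n) (recip n) (integral⇒∈p^0 (integral-recip p∤n))
    where
    instance
      n≢0 : NonZero n
      n≢0 = ∤⇒NonZero p∤n

  unit-· : ∀ {u u′} → Unit u → Unit u′ → Unit (u · u′)
  unit-· {u} {u′} (unit v uv≡1 v∈) (unit v′ uv′≡1 v′∈) =
    unit (v · v′) (trans (interchange u u′ v v′) (cong₂ _·_ uv≡1 uv′≡1)) (∈p^-· v∈ v′∈)
    where
    interchange : ∀ a b c d → a · b · (c · d) ≡ a · c · (b · d)
    interchange = solve-∀ ring

  unit-neg : ∀ {u} → Unit u → Unit (- u)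
  unit-neg {u} (unit v uv≡1 v∈) = unit (- v) (trans (signs u v) uv≡1) (∈p^-neg v∈)
    where
    signs : ∀ a b → (- a) · (- b) ≡ a · b
    signs = solve-∀ ring

  cancel-ι : ∀ {k} n → p ∤ n → ∀ {x} → ι n · x ∈p^ k → x ∈p^ k
  cancel-ι n p∤n = cancel-unit (unit-ι n p∤n)

  cancel-p : ∀ {k x} → ι p · x ∈p^ suc k → x ∈p^ k
  cancel-p {k} {x} (multiple z iz eq) = multiple z iz (ι-cancel p (begin
      ι p · x                      ≡⟨ eq ⟩
      ι (p ℕ.* p ^ k) · z          ≡⟨ cong (_· z) (ι-· p (p ^ k)) ⟩
      ι p · ι (p ^ k) · z          ≡⟨ ℚₚ.*-assoc (ι p) (ι (p ^ k)) z ⟩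
      ι p · (ι (p ^ k) · z)        ∎))

  p∈p^1 : ι p ∈p^ 1
  p∈p^1 = ∈p^-resp (cong ι (ℕₚ.*-identityʳ p)) (p^∈p^ 1)

  -- Each step gains one power of p.
  cancel-near-unit : ∀ k {u e x} → Unit u → e ∈p^ 1 → x ∈p^ 0 → x · (u + e) ∈p^ k → x ∈p^ k
  cancel-near-unit zero    u⁻¹ e∈ x∈ xue∈ = x∈
  cancel-near-unit (suc k) {u} {e} {x} u⁻¹ e∈ x∈ xue∈ = cancel-unit u⁻¹ (∈p^-resp (isolate x u e)
    (∈p^-- xue∈ (∈p^-· e∈ (cancel-near-unit k u⁻¹ e∈ x∈ (∈p^-drop 1 xue∈)))))
    where
    isolate : ∀ x u e → x · (u + e) - e · x ≡ u · x
    isolate = solve-∀ ring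

  p∣numerator⇒∈p^1 : ∀ {x} → x ∈p^ 0 → p ∣ ∣ ↥ x ∣ → x ∈p^ 1
  p∣numerator⇒∈p^1 {x} x∈ p∣↥x with ℤ∣.∣ᵤ⇒∣ {+ p} {↥ x} p∣↥x
  ... | ℤ∣.divides q ↥x≡q*p = cancel-ι (↧ₙ x) (∈p^0⇒integral x∈) (∈p^-resp (begin
      ℤ→ℚ q · ι p          ≡⟨ sym (ℤ→ℚ-homo-· q (+ p)) ⟩
      ℤ→ℚ (q ℤ.* (+ p))    ≡⟨ cong ℤ→ℚ (sym ↥x≡q*p) ⟩
      ℤ→ℚ (↥ x)            ≡⟨ sym (numerator/denominator x) ⟩
      x · ι (↧ₙ x)         ≡⟨ ℚₚ.*-comm x (ι (↧ₙ x)) ⟩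
      ι (↧ₙ x) · x         ∎) (∈p^-· (ℤ∈p^0 q) p∈p^1))

  -- Cross-multiplying `x = p · z` equates `↥ x` times `↧ z` with a multiple of `p`; as `p` does not
  -- divide `↧ z`, Euclid's lemma leaves the numerator of `x`.
  ∈p^1⇒p∣numerator : ∀ {x} → x ∈p^ 1 → p ∣ ∣ ↥ x ∣
  ∈p^1⇒p∣numerator {x} (multiple z iz eq) with euclidsLemma ∣ ↥ x ∣ (↧ₙ z) pp
    (subst (p ∣_) (sym (cross-multiply-ℕ x (↧ₙ z) ((+ p) ℤ.* ↥ z) (begin
      x · ι (↧ₙ z)                     ≡⟨ cong (_· ι (↧ₙ z)) eq ⟩
      ι (p ^ 1) · z · ι (↧ₙ z)         ≡⟨ ℚₚ.*-assoc (ι (p ^ 1)) z (ι (↧ₙ z)) ⟩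
      ι (p ^ 1) · (z · ι (↧ₙ z))       ≡⟨ cong₂ _·_ (cong ι (ℕₚ.*-identityʳ p)) (numerator/denominator z) ⟩
      ι p · ℤ→ℚ (↥ z)                  ≡⟨ sym (ℤ→ℚ-homo-· (+ p) (↥ z)) ⟩
      ℤ→ℚ ((+ p) ℤ.* ↥ z)              ∎)))
      (∣.∣m⇒∣m*n (↧ₙ x) (subst (p ∣_) (sym (ℤₚ.abs-* (+ p) (↥ z))) (∣.m∣m*n ∣ ↥ z ∣))))
  ... | inj₁ p∣↥x = p∣↥x
  ... | inj₂ p∣↧z = contradiction p∣↧z iz

-- Finite sums, products and powers.

∑ : (ℕ → ℚ) → ℕ → ℚ
∑ f zero    = 0ℚ
∑ f (suc n) = ∑ f n + f n

∏ : (ℕ → ℚ) → ℕ → ℚ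
∏ f zero    = 1ℚ
∏ f (suc n) = ∏ f n · f n

∑-cong : ∀ {f g} n → (∀ i → i < n → f i ≡ g i) → ∑ f n ≡ ∑ g n
∑-cong zero    f≗g = refl
∑-cong (suc n) f≗g = cong₂ _+_ (∑-cong n λ i i<n → f≗g i (ℕₚ.m<n⇒m<1+n i<n)) (f≗g n ℕₚ.≤-refl)

∏-cong : ∀ {f g} n → (∀ i → i < n → f i ≡ g i) → ∏ f n ≡ ∏ g n
∏-cong zero    f≗g = refl
∏-cong (suc n) f≗g = cong₂ _·_ (∏-cong n λ i i<n → f≗g i (ℕₚ.m<n⇒m<1+n i<n)) (f≗g n ℕₚ.≤-refl)

∑-+ : ∀ f g n → ∑ (λ i → f i + g i) n ≡ ∑ f n + ∑ g n
∑-+ f g zero    = refl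
∑-+ f g (suc n) = trans (cong (_+ (f n + g n)) (∑-+ f g n)) (interchange (∑ f n) (∑ g n) (f n) (g n))
  where
  interchange : ∀ a b c d → a + b + (c + d) ≡ a + c + (b + d)
  interchange = solve-∀ ring

∏-· : ∀ f g n → ∏ (λ i → f i · g i) n ≡ ∏ f n · ∏ g n
∏-· f g zero    = refl
∏-· f g (suc n) = trans (cong (_· (f n · g n)) (∏-· f g n)) (interchange (∏ f n) (∏ g n) (f n) (g n))
  where
  interchange : ∀ a b c d → a · b · (c · d) ≡ a · c · (b · d)
  interchange = solve-∀ ring

∑-·ˡ : ∀ c f n → ∑ (λ i → c · f i) n ≡ c · ∑ f n
∑-·ˡ c f zero    = sym (ℚₚ.*-zeroʳ c)
∑-·ˡ c f (suc n) = trans (cong (_+ c · f n) (∑-·ˡ c f n)) (sym (ℚₚ.*-distribˡ-+ c (∑ f n) (f n)))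

∑-- : ∀ f g n → ∑ (λ i → f i - g i) n ≡ ∑ f n - ∑ g n
∑-- f g zero    = refl
∑-- f g (suc n) = trans (cong (_+ (f n - g n)) (∑-- f g n)) (interchange (∑ f n) (∑ g n) (f n) (g n))
  where
  interchange : ∀ a b c d → a - b + (c - d) ≡ a + c - (b + d)
  interchange = solve-∀ ring

∑-shift : ∀ f n → ∑ f (suc n) ≡ f 0 + ∑ (λ i → f (suc i)) n
∑-shift f zero    = ℚₚ.+-comm 0ℚ (f 0)
∑-shift f (suc n) = trans (cong (_+ f (suc n)) (∑-shift f n)) (ℚₚ.+-assoc (f 0) _ (f (suc n)))

∏-shift : ∀ f n → ∏ f (suc n) ≡ f 0 · ∏ (λ i → f (suc i)) n
∏-shift f zero    = ℚₚ.*-comm 1ℚ (f 0)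
∏-shift f (suc n) = trans (cong (_· f (suc n)) (∏-shift f n)) (ℚₚ.*-assoc (f 0) _ (f (suc n)))

∑-reverse : ∀ f n → ∑ (λ i → f (n ∸ suc i)) n ≡ ∑ f n
∑-reverse f zero    = refl
∑-reverse f (suc n) = begin
  ∑ (λ i → f (n ∸ i)) (suc n)            ≡⟨ ∑-shift (λ i → f (n ∸ i)) n ⟩
  f n + ∑ (λ i → f (n ∸ suc i)) n        ≡⟨ cong (λ z → f n + z) (∑-reverse f n) ⟩
  f n + ∑ f n                            ≡⟨ ℚₚ.+-comm (f n) (∑ f n) ⟩
  ∑ f n + f n                            ∎

∏-reverse : ∀ f n → ∏ (λ i → f (n ∸ suc i)) n ≡ ∏ f n
∏-reverse f zero    = refl
∏-reverse f (suc n) = begin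
  ∏ (λ i → f (n ∸ i)) (suc n)            ≡⟨ ∏-shift (λ i → f (n ∸ i)) n ⟩
  f n · ∏ (λ i → f (n ∸ suc i)) n        ≡⟨ cong (f n ·_) (∏-reverse f n) ⟩
  f n · ∏ f n                            ≡⟨ ℚₚ.*-comm (f n) (∏ f n) ⟩
  ∏ f n · f n                            ∎

∑-swap : ∀ (f : ℕ → ℕ → ℚ) m n → ∑ (λ i → ∑ (f i) n) m ≡ ∑ (λ j → ∑ (λ i → f i j) m) n
∑-swap f zero    n = sym (∑-0 n)
  where
  ∑-0 : ∀ n → ∑ (λ _ → 0ℚ) n ≡ 0ℚ
  ∑-0 zero    = refl
  ∑-0 (suc n) = trans (ℚₚ.+-identityʳ _) (∑-0 n)
∑-swap f (suc m) n = trans (cong (_+ ∑ (f m) n) (∑-swap f m n)) (sym (∑-+ (λ j → ∑ (λ i → f i j) m) (f m) n))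

∑-telescope : ∀ (f : ℕ → ℚ) n → ∑ (λ i → f (suc i) - f i) n ≡ f n - f 0
∑-telescope f zero    = sym (ℚₚ.+-inverseʳ (f 0))
∑-telescope f (suc n) = trans (cong (_+ (f (suc n) - f n)) (∑-telescope f n)) (collapse (f 0) (f n) (f (suc n)))
  where
  collapse : ∀ a b c → b - a + (c - b) ≡ c - a
  collapse = solve-∀ ring

infixr 8 _^ℚ_

_^ℚ_ : ℚ → ℕ → ℚ
x ^ℚ zero  = 1ℚ
x ^ℚ suc k = x · x ^ℚ k

-- Newton's identities

shift : (ℕ → ℚ) → ℕ → ℚ
shift f zero    = 0ℚ
shift f (suc k) = f k

-- The Cauchy product `∑ f (k - i) · g i`. The recursion advances `g` and keeps `f` fixed, so
-- inductions generalise over `g`; in these terms `shift` is multiplication by `X`.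
convolve : (ℕ → ℚ) → (ℕ → ℚ) → ℕ → ℚ
convolve f g zero    = f 0 · g 0
convolve f g (suc k) = f (suc k) · g 0 + convolve f (λ i → g (suc i)) k

-- The coefficient of Xᵏ in ∏_{j<n} (1 - x_j X); this choice of signs keeps Newton's identities sign-free.
e : (ℕ → ℚ) → ℕ → ℕ → ℚ
e x zero    zero    = 1ℚ
e x zero    (suc k) = 0ℚ
e x (suc n) k       = e x n k - x n · shift (e x n) k

powerSum : (ℕ → ℚ) → ℕ → ℕ → ℚ
powerSum x n k = ∑ (λ j → x j ^ℚ k) n

e-0 : ∀ x n → e x n 0 ≡ 1ℚ
e-0 x zero    = refl
e-0 x (suc n) = trans (drop (e x n 0) (x n)) (e-0 x n)
  where
  drop : ∀ a y → a - y · 0ℚ ≡ a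
  drop = solve-∀ ring

e-vanish : ∀ x n k → n < k → e x n k ≡ 0ℚ
e-vanish x zero    (suc k) _         = refl
e-vanish x (suc n) (suc k) (s≤s n<k) = trans
  (cong₂ (λ a b → a - x n · b) (e-vanish x n (suc k) (ℕₚ.m<n⇒m<1+n n<k)) (e-vanish x n k n<k))
  (collapse (x n))
  where
  collapse : ∀ y → 0ℚ - y · 0ℚ ≡ 0ℚ
  collapse = solve-∀ ring

-- Since `x t = 1`, each factor satisfies `1 - xX = (- x) X (1 - t/X)`; multiplying over `j` and
-- comparing coefficients reverses the order of the indices.
e-reverse : ∀ x t → (∀ j → x j · t j ≡ 1ℚ) → ∀ n i k → i ℕ.+ k ≡ n →
            e x n i ≡ ∏ (λ j → - x j) n · e t n k
e-reverse x t xt≡1 zero    zero    zero    refl = refl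
e-reverse x t xt≡1 (suc n) zero    .(suc n) refl = begin
  e x n 0 - x n · 0ℚ                          ≡⟨ cong (λ a → a - x n · 0ℚ) (e-reverse x t xt≡1 n 0 n refl) ⟩
  b · e t n n - x n · 0ℚ                      ≡⟨ cong (_- x n · 0ℚ) (sym (ℚₚ.*-identityˡ (b · e t n n))) ⟩
  1ℚ · (b · e t n n) - x n · 0ℚ               ≡⟨ cong (λ a → a · (b · e t n n) - x n · 0ℚ) (sym (xt≡1 n)) ⟩
  x n · t n · (b · e t n n) - x n · 0ℚ        ≡⟨ regroup (x n) (t n) b (e t n n) ⟩
  b · (- x n) · (0ℚ - t n · e t n n)          ≡⟨ cong (λ a → b · (- x n) · (a - t n · e t n n)) (sym (e-vanish t n (suc n) ℕₚ.≤-refl)) ⟩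
  b · (- x n) · (e t n (suc n) - t n · e t n n) ∎
  where
  b = ∏ (λ j → - x j) n
  regroup : ∀ x t b a → x · t · (b · a) - x · 0ℚ ≡ b · (- x) · (0ℚ - t · a)
  regroup = solve-∀ ring
e-reverse x t xt≡1 (suc n) (suc i) zero    eq
  -- Here `i = n`, so the first term has index `n + 1`, beyond the number of variables, and
  -- `e-vanish` removes it.
  rewrite trans (sym (ℕₚ.+-identityʳ i)) (ℕₚ.suc-injective eq) = begin
  e x n (suc n) - x n · e x n n               ≡⟨ cong₂ (λ a c → a - x n · c) (e-vanish x n (suc n) ℕₚ.≤-refl) (e-reverse x t xt≡1 n n 0 (ℕₚ.+-identityʳ n)) ⟩
  0ℚ - x n · (b · e t n 0)                    ≡⟨ regroup (x n) (t n) b (e t n 0) ⟩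
  b · (- x n) · (e t n 0 - t n · 0ℚ)          ∎
  where
  b = ∏ (λ j → - x j) n
  regroup : ∀ x t b a → 0ℚ - x · (b · a) ≡ b · (- x) · (a - t · 0ℚ)
  regroup = solve-∀ ring
e-reverse x t xt≡1 (suc n) (suc i) (suc k) eq = begin
  e x n (suc i) - x n · e x n i                         ≡⟨ cong₂ (λ a c → a - x n · c)
                                                             (e-reverse x t xt≡1 n (suc i) k (trans (sym (ℕₚ.+-suc i k)) (ℕₚ.suc-injective eq)))
                                                             (e-reverse x t xt≡1 n i (suc k) (ℕₚ.suc-injective eq)) ⟩
  b · e t n k - x n · (b · e t n (suc k))               ≡⟨ cong (_- x n · (b · e t n (suc k))) (sym (ℚₚ.*-identityˡ (b · e t n k))) ⟩
  1ℚ · (b · e t n k) - x n · (b · e t n (suc k))        ≡⟨ cong (λ a → a · (b · e t n k) - x n · (b · e t n (suc k))) (sym (xt≡1 n)) ⟩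
  x n · t n · (b · e t n k) - x n · (b · e t n (suc k)) ≡⟨ regroup (x n) (t n) b (e t n k) (e t n (suc k)) ⟩
  b · (- x n) · (e t n (suc k) - t n · e t n k)         ∎
  where
  b = ∏ (λ j → - x j) n
  regroup : ∀ x t b a c → x · t · (b · a) - x · (b · c) ≡ b · (- x) · (c - t · a)
  regroup = solve-∀ ring

convolve-+ʳ : ∀ f g h k → convolve f (λ i → g i + h i) k ≡ convolve f g k + convolve f h k
convolve-+ʳ f g h zero    = ℚₚ.*-distribˡ-+ (f 0) (g 0) (h 0)
convolve-+ʳ f g h (suc k) = trans
  (cong (λ z → f (suc k) · (g 0 + h 0) + z) (convolve-+ʳ f (λ i → g (suc i)) (λ i → h (suc i)) k))
  (regroup (f (suc k)) (g 0) (h 0) _ _)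
  where
  regroup : ∀ a b c d e → a · (b + c) + (d + e) ≡ a · b + d + (a · c + e)
  regroup = solve-∀ ring

convolve-linearˡ : ∀ f f′ c g k → convolve (λ i → f i - c · f′ i) g k ≡ convolve f g k - c · convolve f′ g k
convolve-linearˡ f f′ c g zero    = regroup (f 0) c (f′ 0) (g 0)
  where
  regroup : ∀ a b c d → (a - b · c) · d ≡ a · d - b · (c · d)
  regroup = solve-∀ ring
convolve-linearˡ f f′ c g (suc k) = trans
  (cong (λ z → (f (suc k) - c · f′ (suc k)) · g 0 + z) (convolve-linearˡ f f′ c (λ i → g (suc i)) k))
  (regroup (f (suc k)) c (f′ (suc k)) (g 0) _ _)
  where
  regroup : ∀ a b c d e h → (a - b · c) · d + (e - b · h) ≡ a · d + e - b · (c · d + h)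
  regroup = solve-∀ ring

convolve-zeroʳ : ∀ f k → convolve f (λ _ → 0ℚ) k ≡ 0ℚ
convolve-zeroʳ f zero    = ℚₚ.*-zeroʳ (f 0)
convolve-zeroʳ f (suc k) = trans (cong₂ _+_ (ℚₚ.*-zeroʳ (f (suc k))) (convolve-zeroʳ f k)) refl

convolve-shift : ∀ f g k → convolve (shift f) g (suc k) ≡ convolve f g k
convolve-shift f g zero    = drop (f 0 · g 0) (g 1)
  where
  drop : ∀ a b → a + 0ℚ · b ≡ a
  drop = solve-∀ ring
convolve-shift f g (suc k) = cong (λ z → f (suc k) · g 0 + z) (convolve-shift f (λ i → g (suc i)) k)

-- `1 - yX` is the inverse of the geometric series `∑ yⁱ Xⁱ`, so of the product only `g 0 · f`
-- survives.
convolve-geometric : ∀ f y g → (∀ i → g (suc i) ≡ y · g i) → ∀ k →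
                     convolve (λ i → f i - y · shift f i) g k ≡ g 0 · f k
convolve-geometric f y g geo zero    = drop (f 0) y (g 0)
  where
  drop : ∀ a y b → (a - y · 0ℚ) · b ≡ b · a
  drop = solve-∀ ring
convolve-geometric f y g geo (suc k) = begin
  (f (suc k) - y · f k) · g 0 + convolve _ (λ i → g (suc i)) k
    ≡⟨ cong (λ z → (f (suc k) - y · f k) · g 0 + z) (convolve-geometric f y (λ i → g (suc i)) (λ i → geo (suc i)) k) ⟩
  (f (suc k) - y · f k) · g 0 + g 1 · f k
    ≡⟨ cong (λ a → (f (suc k) - y · f k) · g 0 + a · f k) (geo 0) ⟩
  (f (suc k) - y · f k) · g 0 + y · g 0 · f k
    ≡⟨ collapse (f (suc k)) y (f k) (g 0) ⟩
  g 0 · f (suc k) ∎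
  where
  collapse : ∀ a y b c → (a - y · b) · c + y · c · b ≡ c · a
  collapse = solve-∀ ring

-- The coefficient form of `E · ∑ Sᵢ₊₁ Xⁱ = - dE/dX`, by induction on the number of variables. A new
-- variable `y` multiplies `E` by `1 - yX` and adds the series of `y / (1 - yX)` to the power sums;
-- the two contributions reproduce the product rule.
newton : ∀ x n k → convolve (e x n) (λ i → powerSum x n (suc i)) k ≡ - (ι (suc k) · e x n (suc k))
newton x zero    k = trans (convolve-zeroʳ (e x 0) k) (collapse (ι (suc k)))
  where
  collapse : ∀ a → 0ℚ ≡ - (a · 0ℚ)
  collapse = solve-∀ ring
newton x (suc n) k = begin
  convolve E′ (λ i → g i + x n ^ℚ suc i) k
    ≡⟨ convolve-+ʳ E′ g (λ i → x n ^ℚ suc i) k ⟩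
  convolve E′ g k + convolve E′ (λ i → x n ^ℚ suc i) k
    ≡⟨ cong₂ _+_ (convolve-linearˡ E (shift E) (x n) g k) (convolve-geometric E (x n) (λ i → x n ^ℚ suc i) (λ _ → refl) k) ⟩
  convolve E g k - x n · convolve (shift E) g k + x n · 1ℚ · E k
    ≡⟨ cong₂ (λ a b → a - x n · b + x n · 1ℚ · E k) (newton x n k) (shifted k) ⟩
  - (ι (suc k) · E (suc k)) - x n · (- (ι k · E k)) + x n · 1ℚ · E k
    ≡⟨ cong (λ a → - (a · E (suc k)) - x n · (- (ι k · E k)) + x n · 1ℚ · E k) (ι-suc k) ⟩
  - ((1ℚ + ι k) · E (suc k)) - x n · (- (ι k · E k)) + x n · 1ℚ · E k
    ≡⟨ collect (ι k) (E (suc k)) (x n) (E k) ⟩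
  - ((1ℚ + ι k) · (E (suc k) - x n · E k))
    ≡⟨ cong (λ a → - (a · (E (suc k) - x n · E k))) (sym (ι-suc k)) ⟩
  - (ι (suc k) · (E (suc k) - x n · E k)) ∎
  where
  E  = e x n
  E′ = e x (suc n)
  g : ℕ → ℚ
  g i = powerSum x n (suc i)
  shifted : ∀ k → convolve (shift E) g k ≡ - (ι k · E k)
  shifted zero    = collapse (g 0) (E 0)
    where
    collapse : ∀ a b → 0ℚ · a ≡ - (0ℚ · b)
    collapse = solve-∀ ring
  shifted (suc k) = trans (convolve-shift E g k) (newton x n k)
  collect : ∀ k a y b → - ((1ℚ + k) · a) - y · (- (k · b)) + y · 1ℚ · b ≡ - ((1ℚ + k) · (a - y · b))
  collect = solve-∀ ring

-- Power sums and Bernoulli numbers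

nC0≡1 : ∀ n → n C 0 ≡ 1
nC0≡1 n = trans (nCk≡nC[n∸k] {k = 0} {n = n} z≤n) (nCn≡1 n)

binomial-theorem : ∀ a n → (1ℚ + a) ^ℚ n ≡ ∑ (λ i → ι (n C i) · a ^ℚ i) (suc n)
binomial-theorem a zero    = refl
binomial-theorem a (suc n) = begin
  (1ℚ + a) · (1ℚ + a) ^ℚ n                             ≡⟨ cong ((1ℚ + a) ·_) (binomial-theorem a n) ⟩
  (1ℚ + a) · ∑ f (suc n)                               ≡⟨ expand a (∑ f (suc n)) ⟩
  ∑ f (suc n) + a · ∑ f (suc n)                        ≡⟨ cong₂ _+_ (sym top) (sym (∑-·ˡ a f (suc n))) ⟩
  ∑ f (suc (suc n)) + ∑ (λ i → a · f i) (suc n)        ≡⟨ cong (_+ ∑ (λ i → a · f i) (suc n)) (∑-shift f (suc n)) ⟩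
  f 0 + ∑ (λ i → f (suc i)) (suc n) + ∑ (λ i → a · f i) (suc n)
                                                       ≡⟨ ℚₚ.+-assoc (f 0) (∑ (λ i → f (suc i)) (suc n)) (∑ (λ i → a · f i) (suc n)) ⟩
  f 0 + (∑ (λ i → f (suc i)) (suc n) + ∑ (λ i → a · f i) (suc n))
                                                       ≡⟨ cong₂ _+_ (cong (λ c → ι c · 1ℚ) (trans (nC0≡1 n) (sym (nC0≡1 (suc n))))) (sym (∑-+ (λ i → f (suc i)) (λ i → a · f i) (suc n))) ⟩
  g 0 + ∑ (λ i → f (suc i) + a · f i) (suc n)          ≡⟨ cong (λ z → g 0 + z) (∑-cong (suc n) λ i _ → pascal i) ⟩
  g 0 + ∑ (λ i → g (suc i)) (suc n)                    ≡⟨ sym (∑-shift g (suc n)) ⟩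
  ∑ g (suc (suc n))                                    ∎
  where
  f g : ℕ → ℚ
  f i = ι (n C i) · a ^ℚ i
  g i = ι (suc n C i) · a ^ℚ i
  expand : ∀ a s → (1ℚ + a) · s ≡ s + a · s
  expand = solve-∀ ring
  drop : ∀ s b → s + 0ℚ · b ≡ s
  drop = solve-∀ ring
  -- As `n C (n + 1) = 0`, the sum may be lengthened by one term; after shifting, its terms match
  -- those of the second sum for Pascal's rule.
  top : ∑ f (suc (suc n)) ≡ ∑ f (suc n)
  top = trans (cong (λ c → ∑ f (suc n) + ι c · a ^ℚ suc n) (k>n⇒nCk≡0 (ℕₚ.n<1+n n))) (drop _ (a ^ℚ suc n))
  collect : ∀ c d a b → d · (a · b) + a · (c · b) ≡ (c + d) · (a · b)
  collect = solve-∀ ring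
  pascal : ∀ i → f (suc i) + a · f i ≡ g (suc i)
  pascal i = begin
    ι (n C suc i) · (a · a ^ℚ i) + a · (ι (n C i) · a ^ℚ i)   ≡⟨ collect (ι (n C i)) (ι (n C suc i)) a (a ^ℚ i) ⟩
    (ι (n C i) + ι (n C suc i)) · (a · a ^ℚ i)                ≡⟨ cong (_· (a · a ^ℚ i)) (sym (ι-+ (n C i) (n C suc i))) ⟩
    ι (n C i ℕ.+ n C suc i) · (a · a ^ℚ i)                    ≡⟨ cong (λ c → ι c · (a · a ^ℚ i)) (nCk+nC[k+1]≡[n+1]C[k+1] n i) ⟩
    ι (suc n C suc i) · (a · a ^ℚ i)                          ∎

-- The inner binomial sum is `(j + 1)ⁿ⁺¹ - jⁿ⁺¹`, the expansion without its top term, and summing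
-- over `j < m` telescopes.
powerSum-recurrence : ∀ m n → ∑ (λ i → ι (suc n C i) · powerSum ι m i) (suc n) ≡ ι m ^ℚ suc n
powerSum-recurrence m n = begin
  ∑ (λ i → c i · powerSum ι m i) (suc n)              ≡⟨ ∑-cong (suc n) (λ i _ → sym (∑-·ˡ (c i) (λ j → ι j ^ℚ i) m)) ⟩
  ∑ (λ i → ∑ (λ j → c i · ι j ^ℚ i) m) (suc n)        ≡⟨ ∑-swap (λ i j → c i · ι j ^ℚ i) (suc n) m ⟩
  ∑ (λ j → ∑ (λ i → c i · ι j ^ℚ i) (suc n)) m        ≡⟨ ∑-cong m (λ j _ → difference j) ⟩
  ∑ (λ j → ι (suc j) ^ℚ suc n - ι j ^ℚ suc n) m       ≡⟨ ∑-telescope (λ j → ι j ^ℚ suc n) m ⟩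
  ι m ^ℚ suc n - 0ℚ · 0ℚ ^ℚ n                         ≡⟨ drop (ι m ^ℚ suc n) (0ℚ ^ℚ n) ⟩
  ι m ^ℚ suc n                                        ∎
  where
  c : ℕ → ℚ
  c i = ι (suc n C i)
  drop : ∀ a b → a - 0ℚ · b ≡ a
  drop = solve-∀ ring
  cancel : ∀ s b → s + 1ℚ · b - b ≡ s
  cancel = solve-∀ ring
  difference : ∀ j → ∑ (λ i → c i · ι j ^ℚ i) (suc n) ≡ ι (suc j) ^ℚ suc n - ι j ^ℚ suc n
  difference j = begin
    s                                                       ≡⟨ sym (cancel s (ι j ^ℚ suc n)) ⟩
    s + 1ℚ · ι j ^ℚ suc n - ι j ^ℚ suc n                    ≡⟨ cong (λ d → s + ι d · ι j ^ℚ suc n - ι j ^ℚ suc n) (sym (nCn≡1 (suc n))) ⟩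
    s + c (suc n) · ι j ^ℚ suc n - ι j ^ℚ suc n             ≡⟨ cong (_- ι j ^ℚ suc n) (sym (binomial-theorem (ι j) (suc n))) ⟩
    (1ℚ + ι j) ^ℚ suc n - ι j ^ℚ suc n                      ≡⟨ cong (λ a → a ^ℚ suc n - ι j ^ℚ suc n) (sym (ι-suc j)) ⟩
    ι (suc j) ^ℚ suc n - ι j ^ℚ suc n                       ∎
    where s = ∑ (λ i → c i · ι j ^ℚ i) (suc n)

nC[n-1]≡n : ∀ n → suc n C n ≡ suc n
nC[n-1]≡n n = trans (nCk≡nC[n∸k] (ℕₚ.n≤1+n n)) (trans (cong (suc n C_) (ℕₚ.m+n∸n≡m 1 n)) (nC1≡n (suc n)))

sumℚ-bernoulliList : ∀ (f : ℕ → ℚ → ℚ) m →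
  sumℚ (zipWith f (downFrom (suc m)) (bernoulliList m)) ≡ ∑ (λ j → f j (bernoulli j)) (suc m)
sumℚ-bernoulliList f zero    = ℚₚ.+-comm (f 0 1ℚ) 0ℚ
sumℚ-bernoulliList f (suc m) = trans
  (cong (λ z → f (suc m) (bernoulli (suc m)) + z) (sumℚ-bernoulliList f m)) (ℚₚ.+-comm (f (suc m) (bernoulli (suc m))) _)

-- `bernoulliList` solves exactly this equation for its newest entry, whose coefficient is
-- `suc (suc m)`.
bernoulli-recurrence : ∀ m → ∑ (λ i → ι (suc (suc m) C i) · bernoulli i) (suc (suc m)) ≡ 0ℚ
bernoulli-recurrence m = begin
  s + ι (suc (suc m) C suc m) · bernoulli (suc m)       ≡⟨ cong₂ (λ a b → s + ι a · (- ((+ 1) / suc (suc m) · b))) (nC[n-1]≡n (suc m)) (sumℚ-bernoulliList _ m) ⟩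
  s + ι (suc (suc m)) · (- ((+ 1) / suc (suc m) · s))   ≡⟨ regroup s (ι (suc (suc m))) ((+ 1) / suc (suc m)) ⟩
  s - ι (suc (suc m)) · ((+ 1) / suc (suc m)) · s       ≡⟨ cong (λ a → s - a · s) (recip (suc (suc m))) ⟩
  s - 1ℚ · s                                            ≡⟨ collapse s ⟩
  0ℚ                                                    ∎
  where
  s = ∑ (λ i → ι (suc (suc m) C i) · bernoulli i) (suc m)
  regroup : ∀ s n r → s + n · (- (r · s)) ≡ s - n · r · s
  regroup = solve-∀ ring
  collapse : ∀ s → s - 1ℚ · s ≡ 0ℚ
  collapse = solve-∀ ring

-- Factorials of multiples of `p` and the binomial ratio.

nCk*k![n∸k]!≡n! : ∀ {n k} → k ≤ n → (n C k) ℕ.* (k ! ℕ.* (n ∸ k) !) ≡ n !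
nCk*k![n∸k]!≡n! {n} {k} k≤n = trans (cong (ℕ._* (k ! ℕ.* (n ∸ k) !)) (nCk≡n!/k![n-k]! k≤n))
  (m/n*n≡m {{k !* (n ∸ k) !≢0}} (k![n∸k]!∣n! k≤n))

!-ascending : ∀ m k → ι ((m ℕ.+ k) !) ≡ ι (m !) · ∏ (λ j → ι (m ℕ.+ suc j)) k
!-ascending m zero    = trans (cong (λ a → ι (a !)) (ℕₚ.+-identityʳ m)) (sym (ℚₚ.*-identityʳ (ι (m !))))
!-ascending m (suc k) = begin
  ι ((m ℕ.+ suc k) !)                     ≡⟨ cong (λ a → ι (a !)) (ℕₚ.+-suc m k) ⟩
  ι (suc (m ℕ.+ k) ℕ.* (m ℕ.+ k) !)       ≡⟨ ι-· (suc (m ℕ.+ k)) ((m ℕ.+ k) !) ⟩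
  ι (suc (m ℕ.+ k)) · ι ((m ℕ.+ k) !)     ≡⟨ cong₂ _·_ (cong ι (sym (ℕₚ.+-suc m k))) (!-ascending m k) ⟩
  ι (m ℕ.+ suc k) · (ι (m !) · Π)         ≡⟨ regroup (ι (m ℕ.+ suc k)) (ι (m !)) Π ⟩
  ι (m !) · (Π · ι (m ℕ.+ suc k))         ∎
  where
  Π = ∏ (λ j → ι (m ℕ.+ suc j)) k
  regroup : ∀ a b c → a · (b · c) ≡ b · (c · a)
  regroup = solve-∀ ring

-- The part of (np)! prime to p, in blocks of p - 1 consecutive factors, where p = q + 1.
module Blocks (q : ℕ) where

  p : ℕ
  p = suc q

  block : ℕ → ℚ
  block m = ∏ (λ j → ι (m ℕ.* p ℕ.+ suc j)) q

  blocks : ℕ → ℚ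
  blocks = ∏ block

  [np]! : ∀ n → ι ((n ℕ.* p) !) ≡ ι (p ^ n) · ι (n !) · blocks n
  [np]! zero    = refl
  [np]! (suc n) = begin
    ι ((p ℕ.+ n ℕ.* p) !)                                  ≡⟨ cong (λ a → ι (a !)) (ℕₚ.+-comm p (n ℕ.* p)) ⟩
    ι ((n ℕ.* p ℕ.+ p) !)                                  ≡⟨ !-ascending (n ℕ.* p) p ⟩
    -- The product over `p = suc q` factors unfolds to `block n` times its last factor, the multiple
    -- `(n + 1) p`.
    ι ((n ℕ.* p) !) · (block n · ι (n ℕ.* p ℕ.+ p))        ≡⟨ cong₂ (λ a b → a · (block n · b)) ([np]! n) (cong ι (ℕₚ.+-comm (n ℕ.* p) p)) ⟩
    ι (p ^ n) · ι (n !) · blocks n · (block n · ι (suc n ℕ.* p))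
                                                           ≡⟨ cong (λ a → ι (p ^ n) · ι (n !) · blocks n · (block n · a)) (ι-· (suc n) p) ⟩
    ι (p ^ n) · ι (n !) · blocks n · (block n · (ι (suc n) · ι p))
                                                           ≡⟨ regroup (ι (p ^ n)) (ι (n !)) (blocks n) (block n) (ι (suc n)) (ι p) ⟩
    ι p · ι (p ^ n) · (ι (suc n) · ι (n !)) · (blocks n · block n)
                                                           ≡⟨ sym (cong₂ (λ a b → a · b · (blocks n · block n)) (ι-· p (p ^ n)) (ι-· (suc n) (n !))) ⟩
    ι (p ^ suc n) · ι (suc n !) · (blocks n · block n)     ∎
    where
    regroup : ∀ a b c d e f → a · b · c · (d · (e · f)) ≡ f · a · (e · b) · (c · d)
    regroup = solve-∀ ring

  binomial-blocks : ∀ n r → r ≤ n →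
    ι ((n ℕ.* p) C (r ℕ.* p)) · (blocks r · blocks (n ∸ r)) ≡ ι (n C r) · blocks n
  binomial-blocks n r r≤n = ι-cancel (p ^ n ℕ.* (r ! ℕ.* s !)) {{nonZero}} (begin
    ι (p ^ n ℕ.* (r ! ℕ.* s !)) · (ι Cp · (blocks r · blocks s))
      ≡⟨ cong (_· (ι Cp · (blocks r · blocks s))) (trans (ι-· (p ^ n) (r ! ℕ.* s !)) (cong₂ _·_ p^n≡ (ι-· (r !) (s !)))) ⟩
    ι (p ^ r) · ι (p ^ s) · (ι (r !) · ι (s !)) · (ι Cp · (blocks r · blocks s))
      ≡⟨ regroup₁ (ι (p ^ r)) (ι (p ^ s)) (ι (r !)) (ι (s !)) (ι Cp) (blocks r) (blocks s) ⟩
    ι Cp · (ι (p ^ r) · ι (r !) · blocks r · (ι (p ^ s) · ι (s !) · blocks s))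
      ≡⟨ sym (cong₂ (λ a b → ι Cp · (a · b)) ([np]! r) ([np]! s)) ⟩
    ι Cp · (ι ((r ℕ.* p) !) · ι ((s ℕ.* p) !))
      ≡⟨ cong (ι Cp ·_) (sym (ι-· ((r ℕ.* p) !) ((s ℕ.* p) !))) ⟩
    ι Cp · ι ((r ℕ.* p) ! ℕ.* (s ℕ.* p) !)
      ≡⟨ sym (ι-· Cp ((r ℕ.* p) ! ℕ.* (s ℕ.* p) !)) ⟩
    ι (Cp ℕ.* ((r ℕ.* p) ! ℕ.* (s ℕ.* p) !))
      ≡⟨ cong ι (trans (cong (λ a → Cp ℕ.* ((r ℕ.* p) ! ℕ.* a !)) (ℕₚ.*-distribʳ-∸ p n r)) (nCk*k![n∸k]!≡n! (ℕₚ.*-monoˡ-≤ p r≤n))) ⟩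
    ι ((n ℕ.* p) !)
      ≡⟨ [np]! n ⟩
    ι (p ^ n) · ι (n !) · blocks n
      ≡⟨ cong (λ a → ι (p ^ n) · ι a · blocks n) (sym (nCk*k![n∸k]!≡n! r≤n)) ⟩
    ι (p ^ n) · ι ((n C r) ℕ.* (r ! ℕ.* s !)) · blocks n
      ≡⟨ cong (λ a → ι (p ^ n) · a · blocks n) (ι-· (n C r) (r ! ℕ.* s !)) ⟩
    ι (p ^ n) · (ι (n C r) · ι (r ! ℕ.* s !)) · blocks n
      ≡⟨ regroup₂ (ι (p ^ n)) (ι (n C r)) (ι (r ! ℕ.* s !)) (blocks n) ⟩
    ι (p ^ n) · ι (r ! ℕ.* s !) · (ι (n C r) · blocks n)
      ≡⟨ cong (_· (ι (n C r) · blocks n)) (sym (ι-· (p ^ n) (r ! ℕ.* s !))) ⟩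
    ι (p ^ n ℕ.* (r ! ℕ.* s !)) · (ι (n C r) · blocks n) ∎)
    where
    s  = n ∸ r
    Cp = (n ℕ.* p) C (r ℕ.* p)
    nonZero : NonZero (p ^ n ℕ.* (r ! ℕ.* s !))
    nonZero = ℕₚ.m*n≢0 (p ^ n) (r ! ℕ.* s !) {{ℕₚ.m^n≢0 p n}} {{r !* s !≢0}}
    p^n≡ : ι (p ^ n) ≡ ι (p ^ r) · ι (p ^ s)
    p^n≡ = trans (cong (λ a → ι (p ^ a)) (sym (ℕₚ.m+[n∸m]≡n r≤n)))
      (trans (cong ι (ℕₚ.^-distribˡ-+-* p r s)) (ι-· (p ^ r) (p ^ s)))
    regroup₁ : ∀ a b c d e f g → a · b · (c · d) · (e · (f · g)) ≡ e · (a · c · f · (b · d · g))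
    regroup₁ = solve-∀ ring
    regroup₂ : ∀ a b c d → a · (b · c) · d ≡ a · c · (b · d)
    regroup₂ = solve-∀ ring

  binomRatio-blocks : ∀ n r (r≤n : r ≤ n) →
    binomRatio p n r r≤n · (blocks r · blocks (n ∸ r)) ≡ blocks n
  binomRatio-blocks n r r≤n = ι-cancel (n C r) {{nCk≢0 n r r≤n}} (begin
    ι (n C r) · (ρ · (blocks r · blocks (n ∸ r)))                ≡⟨ regroup (ι (n C r)) ρ (blocks r · blocks (n ∸ r)) ⟩
    ρ · ι (n C r) · (blocks r · blocks (n ∸ r))                  ≡⟨ cong (_· (blocks r · blocks (n ∸ r))) (/-·-cancel (+ ((n ℕ.* p) C (r ℕ.* p))) (n C r) {{nCk≢0 n r r≤n}}) ⟩
    ι ((n ℕ.* p) C (r ℕ.* p)) · (blocks r · blocks (n ∸ r))      ≡⟨ binomial-blocks n r r≤n ⟩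
    ι (n C r) · blocks n                                         ∎)
    where
    ρ = binomRatio p n r r≤n
    regroup : ∀ a b c → a · (b · c) ≡ b · a · c
    regroup = solve-∀ ring

-- Power sums of `1, ..., p - 1` and of their inverses, modulo `p` and `p²`.

x t : ℕ → ℚ
x j = ι (suc j)
t j = (+ 1) / suc j

x·t≡1 : ∀ j → x j · t j ≡ 1ℚ
x·t≡1 j = recip (suc j)

powerSum-0 : ∀ m → powerSum ι m 0 ≡ ι m
powerSum-0 zero    = refl
powerSum-0 (suc m) = trans (cong (_+ 1ℚ) (powerSum-0 m)) (trans (ℚₚ.+-comm (ι m) 1ℚ) (sym (ι-suc m)))

-- A positive exponent kills the term `j = 0`; with exponent `0` that term would count as `1`.
powerSum-suc : ∀ m i → powerSum ι (suc m) (suc i) ≡ powerSum x m (suc i)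
powerSum-suc m i = trans (∑-shift (λ j → ι j ^ℚ suc i) m) (drop (0ℚ ^ℚ i) (powerSum x m (suc i)))
  where
  drop : ∀ a b → 0ℚ · a + b ≡ b
  drop = solve-∀ ring

module Wolstenholme (q : ℕ) (pp : Prime (suc q)) where

  p : ℕ
  p = suc q

  π : ℚ
  π = ι p

  open PAdic p pp

  ∤-suc : ∀ {j} → j < q → p ∤ suc j
  ∤-suc j<q = ∣.>⇒∤ (s≤s j<q)

  x∈p^0 : ∀ j → x j ∈p^ 0
  x∈p^0 j = ι∈p^0 (suc j)

  t∈p^0 : ∀ j → j < q → t j ∈p^ 0
  t∈p^0 j j<q = integral⇒∈p^0 (integral-recip (∤-suc j<q))

  ^ℚ∈p^0 : ∀ {a} → a ∈p^ 0 → ∀ k → a ^ℚ k ∈p^ 0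
  ^ℚ∈p^0 a∈ zero    = ι∈p^0 1
  ^ℚ∈p^0 a∈ (suc k) = ∈p^-· a∈ (^ℚ∈p^0 a∈ k)

  ∑∈p^ : ∀ {k f} n → (∀ i → i < n → f i ∈p^ k) → ∑ f n ∈p^ k
  ∑∈p^ zero    f∈ = 0∈p^ _
  ∑∈p^ (suc n) f∈ = ∈p^-+ (∑∈p^ n λ i i<n → f∈ i (ℕₚ.m<n⇒m<1+n i<n)) (f∈ n ℕₚ.≤-refl)

  ∏∈p^0 : ∀ {f} n → (∀ i → i < n → f i ∈p^ 0) → ∏ f n ∈p^ 0
  ∏∈p^0 zero    f∈ = ι∈p^0 1
  ∏∈p^0 (suc n) f∈ = ∈p^-· (∏∈p^0 n λ i i<n → f∈ i (ℕₚ.m<n⇒m<1+n i<n)) (f∈ n ℕₚ.≤-refl)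

  ∏-cong-mod : ∀ {k f g} n → (∀ i → i < n → f i ∈p^ 0) → (∀ i → i < n → g i ∈p^ 0) →
               (∀ i → i < n → f i - g i ∈p^ k) → ∏ f n - ∏ g n ∈p^ k
  ∏-cong-mod zero    f∈ g∈ f≡g = 0∈p^ _
  ∏-cong-mod {f = f} {g} (suc n) f∈ g∈ f≡g = ∈p^-resp (regroup (∏ f n) (f n) (∏ g n) (g n))
    (∈p^-+ (∈p^-· (f∈ n ℕₚ.≤-refl) (∏-cong-mod n (λ i i<n → f∈ i (ℕₚ.m<n⇒m<1+n i<n))
                                    (λ i i<n → g∈ i (ℕₚ.m<n⇒m<1+n i<n)) (λ i i<n → f≡g i (ℕₚ.m<n⇒m<1+n i<n))))
           (∈p^-· (∏∈p^0 n λ i i<n → g∈ i (ℕₚ.m<n⇒m<1+n i<n)) (f≡g n ℕₚ.≤-refl)))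
    where
    regroup : ∀ F f G g → f · (F - G) + G · (f - g) ≡ F · f - G · g
    regroup = solve-∀ ring

  +-cancelˡ-mod : ∀ {k} a {b} → a + b ∈p^ k → a ∈p^ k → b ∈p^ k
  +-cancelˡ-mod a {b} ab∈ a∈ = ∈p^-resp (cancel a b) (∈p^-- ab∈ a∈)
    where
    cancel : ∀ a b → a + b - a ≡ b
    cancel = solve-∀ ring

  +-cancelʳ-mod : ∀ {k} a b → a + b ∈p^ k → b ∈p^ k → a ∈p^ k
  +-cancelʳ-mod a b ab∈ b∈ = +-cancelˡ-mod b (∈p^-resp (ℚₚ.+-comm a b) ab∈) b∈

  -- The top coefficient is `suc n C n = suc n`, a unit because `n < q`. Hence a binomial recurrence
  -- whose total and earlier terms lie in `pᵏ` determines its last term there too; this serves both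
  -- Bernoulli numbers and power sums.
  last-term : ∀ {k} (f : ℕ → ℚ) n → n < q → ∑ (λ i → ι (suc n C i) · f i) (suc n) ∈p^ k →
              (∀ i → i < n → f i ∈p^ k) → f n ∈p^ k
  last-term f n n<q sum∈ f∈ = cancel-ι (suc n) (∤-suc n<q) (∈p^-resp (cong (λ c → ι c · f n) (nC[n-1]≡n n))
    (+-cancelˡ-mod _ sum∈ (∑∈p^ n λ i i<n → ∈p^-· (ι∈p^0 (suc n C i)) (f∈ i i<n))))

  below-q : (P : ℕ → Set) → (∀ n → n < q → (∀ i → i < n → P i) → P n) → ∀ n → n < q → P n
  below-q P step = <-rec (λ n → n < q → P n) λ n rec n<q →
    step n n<q λ i i<n → rec i<n (ℕₚ.<-trans i<n n<q)

  bernoulli∈p^0 : ∀ n → n < q → bernoulli n ∈p^ 0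
  bernoulli∈p^0 = below-q (λ n → bernoulli n ∈p^ 0) step
    where
    step : ∀ n → n < q → (∀ i → i < n → bernoulli i ∈p^ 0) → bernoulli n ∈p^ 0
    step zero    _   _  = ι∈p^0 1
    step (suc m) m<q B∈ = last-term bernoulli (suc m) m<q (∈p^-resp (sym (bernoulli-recurrence m)) (0∈p^ 0)) B∈

  -- Power sums and `p` times the Bernoulli numbers obey the same recurrence except for the
  -- right-hand side, `p^N` against `0`. For positive index `N ≥ 2`, so the difference is driven by
  -- a multiple of `p²`; at index `0` both are exactly `p`.
  powerSum≡pB : ∀ n → n < q → powerSum ι p n - π · bernoulli n ∈p^ 2
  powerSum≡pB = below-q (λ n → d n ∈p^ 2) step
    where
    d : ℕ → ℚ
    d i = powerSum ι p i - π · bernoulli i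
    split : ∀ c a π b → c · (a - π · b) ≡ c · a - π · (c · b)
    split = solve-∀ ring
    step : ∀ n → n < q → (∀ i → i < n → d i ∈p^ 2) → d n ∈p^ 2
    step zero    _   _  = ∈p^-resp (sym (trans (cong (_- π · 1ℚ) (powerSum-0 p)) (collapse π))) (0∈p^ 2)
      where
      collapse : ∀ a → a - a · 1ℚ ≡ 0ℚ
      collapse = solve-∀ ring
    step (suc m) m<q d∈ = last-term d (suc m) m<q (∈p^-resp (sym eq) (∈p^-· p∈p^1 (∈p^-· p∈p^1 (^ℚ∈p^0 (ι∈p^0 p) m)))) d∈
      where
      c : ℕ → ℚ
      c i = ι (suc (suc m) C i)
      N = suc (suc m)
      drop : ∀ a b → a - b · 0ℚ ≡ a
      drop = solve-∀ ring
      eq : ∑ (λ i → c i · d i) N ≡ π ^ℚ N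
      eq = begin
        ∑ (λ i → c i · d i) N
          ≡⟨ ∑-cong N (λ i _ → split (c i) (powerSum ι p i) π (bernoulli i)) ⟩
        ∑ (λ i → c i · powerSum ι p i - π · (c i · bernoulli i)) N
          ≡⟨ ∑-- (λ i → c i · powerSum ι p i) (λ i → π · (c i · bernoulli i)) N ⟩
        ∑ (λ i → c i · powerSum ι p i) N - ∑ (λ i → π · (c i · bernoulli i)) N
          ≡⟨ cong₂ _-_ (powerSum-recurrence p (suc m)) (trans (∑-·ˡ π (λ i → c i · bernoulli i) N) (cong (π ·_) (bernoulli-recurrence m))) ⟩
        π ^ℚ N - π · 0ℚ
          ≡⟨ drop (π ^ℚ N) π ⟩
        π ^ℚ N ∎

  S≡pB : ∀ n → suc n < q → powerSum x q (suc n) - π · bernoulli (suc n) ∈p^ 2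
  S≡pB n n<q = ∈p^-resp (cong (_- π · bernoulli (suc n)) (powerSum-suc q n)) (powerSum≡pB (suc n) n<q)

  S∈p^1 : ∀ n → suc n < q → powerSum x q (suc n) ∈p^ 1
  S∈p^1 n n<q = ∈p^-resp (cancel (powerSum x q (suc n)) (π · bernoulli (suc n)))
    (∈p^-+ (∈p^-drop 1 (S≡pB n n<q)) (∈p^-· p∈p^1 (bernoulli∈p^0 (suc n) n<q)))
    where
    cancel : ∀ a b → a - b + b ≡ a
    cancel = solve-∀ ring

  -- Every term but the one with `f 0` pairs a value of `f` at a positive index with a value of `g`
  -- before `k`, so the divisibilities add.
  convolve-leading : ∀ {a b} f g k → (∀ i → i < k → f (suc i) ∈p^ a) → (∀ i → i < k → g i ∈p^ b) →
                     convolve f g k - f 0 · g k ∈p^ (a ℕ.+ b)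
  convolve-leading f g zero    f∈ g∈ = ∈p^-resp (sym (ℚₚ.+-inverseʳ (f 0 · g 0))) (0∈p^ _)
  convolve-leading f g (suc k) f∈ g∈ = ∈p^-resp (regroup (f (suc k) · g 0) _ (f 0 · g (suc k)))
    (∈p^-+ (∈p^-· (f∈ k ℕₚ.≤-refl) (g∈ 0 (s≤s z≤n)))
           (convolve-leading f (λ i → g (suc i)) k (λ i i<k → f∈ i (ℕₚ.m<n⇒m<1+n i<k)) (λ i i<k → g∈ (suc i) (s≤s i<k))))
    where
    regroup : ∀ a b c → a + (b - c) ≡ a + b - c
    regroup = solve-∀ ring

  module Newton (y : ℕ → ℚ) (y∈ : ∀ j → j < q → y j ∈p^ 0) where

    σ S : ℕ → ℚ
    σ k = e y q k
    S k = powerSum y q k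

    -- Newton's identity with its mixed products discarded. The exponents `(0,1)` and `(1,0)` carry
    -- divisibility by `p` between `S` and `σ`; `(1,1)` gives the linear relation modulo `p²`.
    leading : ∀ {a b} k → (∀ i → i < k → σ (suc i) ∈p^ a) → (∀ i → i < k → S (suc i) ∈p^ b) →
              ι (suc k) · σ (suc k) + S (suc k) ∈p^ (a ℕ.+ b)
    leading k σ∈ S∈ = ∈p^-resp (begin
        - (convolve σ (λ i → S (suc i)) k - σ 0 · S (suc k))     ≡⟨ cong₂ (λ a b → - (a - b · S (suc k))) (newton y q k) (e-0 y q) ⟩
        - (- (ι (suc k) · σ (suc k)) - 1ℚ · S (suc k))           ≡⟨ collapse (ι (suc k) · σ (suc k)) (S (suc k)) ⟩
        ι (suc k) · σ (suc k) + S (suc k)                        ∎)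
      (∈p^-neg (convolve-leading σ (λ i → S (suc i)) k σ∈ S∈))
      where
      collapse : ∀ a b → - (- a - 1ℚ · b) ≡ a + b
      collapse = solve-∀ ring

    σ∈p^0 : ∀ k → σ k ∈p^ 0
    σ∈p^0 = go q ℕₚ.≤-refl
      where
      shift∈ : ∀ {f} → (∀ k → f k ∈p^ 0) → ∀ k → shift f k ∈p^ 0
      shift∈ f∈ zero    = 0∈p^ 0
      shift∈ f∈ (suc k) = f∈ k
      go : ∀ n → n ≤ q → ∀ k → e y n k ∈p^ 0
      go zero    _   zero    = ι∈p^0 1
      go zero    _   (suc k) = 0∈p^ 0
      go (suc n) n<q k       = ∈p^-- (go n (ℕₚ.<⇒≤ n<q) k) (∈p^-· (y∈ n n<q) (shift∈ (go n (ℕₚ.<⇒≤ n<q)) k))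

    S∈p^0 : ∀ k → S k ∈p^ 0
    S∈p^0 k = ∑∈p^ q λ j j<q → ^ℚ∈p^0 (y∈ j j<q) k

    -- Each mixed product contains a lower power sum, so mere integrality of `σ` suffices and no
    -- induction on `k` is required.
    S⇒σ : (∀ i → suc i < q → S (suc i) ∈p^ 1) → ∀ k → suc k < q → σ (suc k) ∈p^ 1
    S⇒σ S∈ k k<q = cancel-ι (suc k) (∤-suc (ℕₚ.<⇒≤ k<q)) (+-cancelʳ-mod (ι (suc k) · σ (suc k)) (S (suc k))
      (leading {0} {1} k (λ i _ → σ∈p^0 (suc i)) (λ i i<k → S∈ i (ℕₚ.<-trans (s≤s i<k) k<q)))
      (S∈ k k<q))

    σ⇒S : (∀ i → suc i < q → σ (suc i) ∈p^ 1) → ∀ k → suc k < q → S (suc k) ∈p^ 1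
    σ⇒S σ∈ k k<q = +-cancelˡ-mod (ι (suc k) · σ (suc k))
      (leading {1} {0} k (λ i i<k → σ∈ i (ℕₚ.<-trans (s≤s i<k) k<q)) (λ i _ → S∈p^0 (suc i)))
      (∈p^-· (ι∈p^0 (suc k)) (σ∈ k k<q))

  module X = Newton x (λ j _ → x∈p^0 j)
  module T = Newton t t∈p^0

  unit-∏ : ∀ {f} n → (∀ i → i < n → Unit (f i)) → Unit (∏ f n)
  unit-∏ zero    u = unit 1ℚ refl (ι∈p^0 1)
  unit-∏ (suc n) u = unit-· (unit-∏ n λ i i<n → u i (ℕₚ.m<n⇒m<1+n i<n)) (u n ℕₚ.≤-refl)

  b₀ : ℚ
  b₀ = ∏ (λ j → - x j) q

  b₀-unit : Unit b₀
  b₀-unit = unit-∏ q λ j j<q → unit-neg (unit-ι (suc j) (∤-suc j<q))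

  X≡b₀T : ∀ i k → i ℕ.+ k ≡ q → X.σ i ≡ b₀ · T.σ k
  X≡b₀T = e-reverse x t x·t≡1 q

  Xσ∈p^1 : ∀ k → suc k < q → X.σ (suc k) ∈p^ 1
  Xσ∈p^1 = X.S⇒σ S∈p^1

  Tσ∈p^1 : ∀ k → suc k < q → T.σ (suc k) ∈p^ 1
  Tσ∈p^1 k k<q = cancel-unit b₀-unit (∈p^-resp (X≡b₀T (suc i) (suc k) i+k≡q) (Xσ∈p^1 i i<q))
    where
    -- Reversal sends the index `k + 1` to `q - (k + 1) = suc i`, which again lies strictly between
    -- `0` and `q`.
    i = q ∸ suc (suc k)
    i+k≡q : suc i ℕ.+ suc k ≡ q
    i+k≡q = trans (sym (ℕₚ.+-suc i (suc k))) (ℕₚ.m∸n+n≡m k<q)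
    i<q : suc i < q
    i<q = subst (suc i <_) i+k≡q (ℕₚ.m<m+n (suc i) (s≤s z≤n))

  -- Divisibility by `p` travels from the power sums of `x` to their symmetric functions, by
  -- reversal to those of `t`, and back to power sums; this replaces an appeal to Fermat's theorem.
  H∈p^1 : ∀ k → suc k < q → T.S (suc k) ∈p^ 1
  H∈p^1 = T.σ⇒S Tσ∈p^1

-- Sums of oblong numbers and the factor `n r (n - r)`.

2ℚ : ℚ
2ℚ = ι 2

2·-double : ∀ a → 2ℚ · a ≡ a + a
2·-double a = trans (cong (_· a) (ι-suc 1)) (double a)
  where
  double : ∀ a → (1ℚ + 1ℚ) · a ≡ a + a
  double = solve-∀ ring

-- Equals (n³ - n)/3.
oblongSum : ℕ → ℚ
oblongSum = ∑ (λ m → ι m · ι m + ι m)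

-- The origin of `n r (n - r)`: it is the failure of `(n³ - n)/3` to be additive, as
-- `(r + s)³ - r³ - s³ = 3 r s (r + s)`. Induction on `s` avoids the division by `3`.
oblongSum-+ : ∀ r s → oblongSum (r ℕ.+ s) ≡ oblongSum r + oblongSum s + ι (r ℕ.+ s) · ι r · ι s
oblongSum-+ r zero    = trans (cong oblongSum (ℕₚ.+-identityʳ r)) (drop (oblongSum r) (ι (r ℕ.+ 0) · ι r))
  where
  drop : ∀ a b → a ≡ a + 0ℚ + b · 0ℚ
  drop = solve-∀ ring
oblongSum-+ r (suc s) = begin
  oblongSum (r ℕ.+ suc s)
    ≡⟨ cong oblongSum (ℕₚ.+-suc r s) ⟩
  oblongSum (r ℕ.+ s) + (ι (r ℕ.+ s) · ι (r ℕ.+ s) + ι (r ℕ.+ s))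
    ≡⟨ cong (_+ (ι (r ℕ.+ s) · ι (r ℕ.+ s) + ι (r ℕ.+ s))) (oblongSum-+ r s) ⟩
  oblongSum r + oblongSum s + ι (r ℕ.+ s) · ι r · ι s + (ι (r ℕ.+ s) · ι (r ℕ.+ s) + ι (r ℕ.+ s))
    ≡⟨ cong (λ n → oblongSum r + oblongSum s + n · ι r · ι s + (n · n + n)) (ι-+ r s) ⟩
  oblongSum r + oblongSum s + (ι r + ι s) · ι r · ι s + ((ι r + ι s) · (ι r + ι s) + (ι r + ι s))
    ≡⟨ step (oblongSum r) (oblongSum s) (ι r) (ι s) ⟩
  oblongSum r + (oblongSum s + (ι s · ι s + ι s)) + (ι r + (1ℚ + ι s)) · ι r · (1ℚ + ι s)
    ≡⟨ cong (λ a → oblongSum r + oblongSum (suc s) + (ι r + a) · ι r · a) (sym (ι-suc s)) ⟩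
  oblongSum r + oblongSum (suc s) + (ι r + ι (suc s)) · ι r · ι (suc s)
    ≡⟨ cong (λ a → oblongSum r + oblongSum (suc s) + a · ι r · ι (suc s)) (sym (ι-+ r (suc s))) ⟩
  oblongSum r + oblongSum (suc s) + ι (r ℕ.+ suc s) · ι r · ι (suc s) ∎
  where
  step : ∀ a b r s → a + b + (r + s) · r · s + ((r + s) · (r + s) + (r + s)) ≡
                     a + (b + (s · s + s)) + (r + (1ℚ + s)) · r · (1ℚ + s)
  step = solve-∀ ring

^ℚ-+ : ∀ a r s → a ^ℚ (r ℕ.+ s) ≡ a ^ℚ r · a ^ℚ s
^ℚ-+ a zero    s = sym (ℚₚ.*-identityˡ (a ^ℚ s))
^ℚ-+ a (suc r) s = trans (cong (a ·_) (^ℚ-+ a r s)) (sym (ℚₚ.*-assoc a (a ^ℚ r) (a ^ℚ s)))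

-- Paired inverses and the block products modulo `p⁵`.

module Binomial (q : ℕ) (pp : Prime (suc q)) (6≤q : 6 ≤ q) where

  open PAdic (suc q) pp
  open Wolstenholme q pp
  open Blocks q using (block; blocks; binomRatio-blocks)

  t′ s : ℕ → ℚ
  t′ j = t (q ∸ suc j)
  s j  = t j · t′ j

  x+x′≡π : ∀ j → j < q → x j + x (q ∸ suc j) ≡ π
  x+x′≡π j j<q = trans (sym (ι-+ (suc j) (suc (q ∸ suc j))))
    (cong ι (trans (ℕₚ.+-suc (suc j) (q ∸ suc j)) (cong suc (ℕₚ.m+[n∸m]≡n j<q))))

  t′∈p^0 : ∀ j → j < q → t′ j ∈p^ 0
  t′∈p^0 j j<q = t∈p^0 (q ∸ suc j) (ℕₚ.∸-monoʳ-< (s≤s z≤n) j<q)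

  s∈p^0 : ∀ j → j < q → s j ∈p^ 0
  s∈p^0 j j<q = ∈p^-· (t∈p^0 j j<q) (t′∈p^0 j j<q)

  t+t′≡πs : ∀ j → j < q → t j + t′ j ≡ π · s j
  t+t′≡πs j j<q = begin
    t j + t′ j                                             ≡⟨ sym (cong₂ _+_ (ℚₚ.*-identityˡ (t j)) (ℚₚ.*-identityˡ (t′ j))) ⟩
    1ℚ · t j + 1ℚ · t′ j                                   ≡⟨ sym (cong₂ (λ a b → a · t j + b · t′ j) (x·t≡1 (q ∸ suc j)) (x·t≡1 j)) ⟩
    x (q ∸ suc j) · t′ j · t j + x j · t j · t′ j          ≡⟨ regroup (x j) (x (q ∸ suc j)) (t j) (t′ j) ⟩
    (x j + x (q ∸ suc j)) · s j                            ≡⟨ cong (_· s j) (x+x′≡π j j<q) ⟩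
    π · s j                                                ∎
    where
    regroup : ∀ x x′ t t′ → x′ · t′ · t + x · t · t′ ≡ (x + x′) · (t · t′)
    regroup = solve-∀ ring

  H σ₁ σ₂ : ℚ
  H  = harmonic q
  σ₁ = ∑ s q
  σ₂ = ∑ (λ j → s j · s j) q

  2H≡πσ₁ : 2ℚ · H ≡ π · σ₁
  2H≡πσ₁ = begin
    2ℚ · H                         ≡⟨ 2·-double H ⟩
    H + H                          ≡⟨ cong₂ _+_ (harmonic≡∑ q) (trans (harmonic≡∑ q) (sym (∑-reverse t q))) ⟩
    ∑ t q + ∑ t′ q                 ≡⟨ sym (∑-+ t t′ q) ⟩
    ∑ (λ j → t j + t′ j) q         ≡⟨ ∑-cong q t+t′≡πs ⟩
    ∑ (λ j → π · s j) q            ≡⟨ ∑-·ˡ π s q ⟩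
    π · σ₁                         ∎
    where
    harmonic≡∑ : ∀ n → harmonic n ≡ ∑ t n
    harmonic≡∑ zero    = refl
    harmonic≡∑ (suc n) = cong (_+ t n) (harmonic≡∑ n)

  -- Modulo `p` one has `t′ ≡ - t`, hence `s ≡ - t²`. The exact error is recorded so that the
  -- relation can be iterated.
  s+t² : ∀ j → j < q → s j + t j · t j ≡ π · (t j · s j)
  s+t² j j<q = begin
    t j · t′ j + t j · t j     ≡⟨ factor (t j) (t′ j) ⟩
    t j · (t j + t′ j)         ≡⟨ cong (t j ·_) (t+t′≡πs j j<q) ⟩
    t j · (π · s j)            ≡⟨ swap (t j) π (s j) ⟩
    π · (t j · s j)            ∎
    where
    factor : ∀ a b → a · b + a · a ≡ a · (a + b)
    factor = solve-∀ ring
    swap : ∀ a b c → a · (b · c) ≡ b · (a · c)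
    swap = solve-∀ ring

  -- Using `s+t²` twice gives `s + t² = - π t³ + π² t² s`. The sum of the cubes `t³` is itself
  -- divisible by `p`, so both parts of the error lie in `p²` after summation.
  H₂+σ₁∈p^2 : T.S 2 + σ₁ ∈p^ 2
  H₂+σ₁∈p^2 = +-cancelˡ-mod (π · T.S 3) (∈p^-resp sum-eq (∑∈p^ q λ j j<q → ∈p^-· p∈p^1 (∈p^-· p∈p^1
      (∈p^-· (t∈p^0 j j<q) (∈p^-· (t∈p^0 j j<q) (s∈p^0 j j<q))))))
    (∈p^-· p∈p^1 (H∈p^1 2 (ℕₚ.≤-trans (ℕₚ.m≤m+n 4 2) 6≤q)))
    where
    expand : ∀ π t s → π · (π · (t · (t · s))) ≡ π · (t · (π · (t · s)))
    expand = solve-∀ ring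
    regroup : ∀ π t s → π · (t · (s + t · t)) ≡ π · (t · s) + π · (t · (t · (t · 1ℚ)))
    regroup = solve-∀ ring
    order : ∀ s t u → s + t · t + u ≡ u + (t · (t · 1ℚ) + s)
    order = solve-∀ ring
    pointwise : ∀ j → j < q → π · (π · (t j · (t j · s j))) ≡ π · t j ^ℚ 3 + (t j ^ℚ 2 + s j)
    pointwise j j<q = begin
      π · (π · (t j · (t j · s j)))                    ≡⟨ expand π (t j) (s j) ⟩
      π · (t j · (π · (t j · s j)))                    ≡⟨ cong (λ a → π · (t j · a)) (sym (s+t² j j<q)) ⟩
      π · (t j · (s j + t j · t j))                    ≡⟨ regroup π (t j) (s j) ⟩
      π · (t j · s j) + π · t j ^ℚ 3                   ≡⟨ cong (_+ π · t j ^ℚ 3) (sym (s+t² j j<q)) ⟩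
      s j + t j · t j + π · t j ^ℚ 3                   ≡⟨ order (s j) (t j) (π · t j ^ℚ 3) ⟩
      π · t j ^ℚ 3 + (t j ^ℚ 2 + s j)                  ∎
    sum-eq : ∑ (λ j → π · (π · (t j · (t j · s j)))) q ≡ π · T.S 3 + (T.S 2 + σ₁)
    sum-eq = begin
      ∑ (λ j → π · (π · (t j · (t j · s j)))) q            ≡⟨ ∑-cong q pointwise ⟩
      ∑ (λ j → π · t j ^ℚ 3 + (t j ^ℚ 2 + s j)) q          ≡⟨ ∑-+ (λ j → π · t j ^ℚ 3) (λ j → t j ^ℚ 2 + s j) q ⟩
      ∑ (λ j → π · t j ^ℚ 3) q + ∑ (λ j → t j ^ℚ 2 + s j) q
                                                           ≡⟨ cong₂ _+_ (∑-·ˡ π (λ j → t j ^ℚ 3) q) (∑-+ (λ j → t j ^ℚ 2) s q) ⟩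
      π · T.S 3 + (T.S 2 + σ₁)                             ∎

  σ₁∈p^1 : σ₁ ∈p^ 1
  σ₁∈p^1 = +-cancelˡ-mod (T.S 2) (∈p^-drop 1 H₂+σ₁∈p^2) (H∈p^1 1 (ℕₚ.≤-trans (ℕₚ.m≤m+n 3 3) 6≤q))

  -- Modulo `p`, `s² ≡ t⁴`, since `s² - t⁴` has the factor `s + t²`. The power sum of order `4`
  -- makes the strongest demand on `q` in this module, `4 < q`.
  σ₂∈p^1 : σ₂ ∈p^ 1
  σ₂∈p^1 = ∈p^-resp (rejoin σ₂ (T.S 4)) (∈p^-+
    (∈p^-resp (∑-- (λ j → s j · s j) (λ j → t j ^ℚ 4) q) (∑∈p^ q λ j j<q →
      ∈p^-resp (difference j j<q) (∈p^-· p∈p^1 (∈p^-· (∈p^-· (t∈p^0 j j<q) (s∈p^0 j j<q))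
        (∈p^-- (s∈p^0 j j<q) (∈p^-· (t∈p^0 j j<q) (t∈p^0 j j<q)))))))
    (H∈p^1 3 (ℕₚ.≤-trans (ℕₚ.m≤m+n 5 1) 6≤q)))
    where
    rejoin : ∀ a b → a - b + b ≡ a
    rejoin = solve-∀ ring
    squares : ∀ s t → (s + t · t) · (s - t · t) ≡ s · s - t · (t · (t · (t · 1ℚ)))
    squares = solve-∀ ring
    difference : ∀ j → j < q → π · (t j · s j · (s j - t j · t j)) ≡ s j · s j - t j ^ℚ 4
    difference j j<q = begin
      π · (t j · s j · (s j - t j · t j))              ≡⟨ sym (ℚₚ.*-assoc π (t j · s j) (s j - t j · t j)) ⟩
      π · (t j · s j) · (s j - t j · t j)              ≡⟨ cong (_· (s j - t j · t j)) (sym (s+t² j j<q)) ⟩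
      (s j + t j · t j) · (s j - t j · t j)            ≡⟨ squares (s j) (t j) ⟩
      s j · s j - t j ^ℚ 4                             ∎

  2-unit : Unit 2ℚ
  2-unit = unit-ι 2 (∤-suc (ℕₚ.≤-trans (ℕₚ.m≤m+n 2 4) 6≤q))

  g : ℚ
  g = π · H

  H∈p^2 : H ∈p^ 2
  H∈p^2 = cancel-unit 2-unit (∈p^-resp (sym 2H≡πσ₁) (∈p^-· p∈p^1 σ₁∈p^1))

  g∈p^3 : g ∈p^ 3
  g∈p^3 = ∈p^-· p∈p^1 H∈p^2

  a₀ : ℚ
  a₀ = ∏ x q

  -- The expansion to second order in `y`, doubled because the quadratic coefficient is half of
  -- `(∑ f)² - ∑ f²`. The remainder `R` is built by ring operations alone and so stays integral.
  ∏-expand : ∀ {y f} n → y ∈p^ 0 → (∀ j → j < n → f j ∈p^ 0) →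
    Σ ℚ λ R → R ∈p^ 0 × 2ℚ · ∏ (λ j → 1ℚ + y · f j) n ≡
      2ℚ + 2ℚ · (y · ∑ f n) + y · y · (∑ f n · ∑ f n - ∑ (λ j → f j · f j) n) + y · y · y · R
  ∏-expand {y} {f} zero    y∈ f∈ = 0ℚ , 0∈p^ 0 , base 2ℚ y
    where
    base : ∀ c y → c · 1ℚ ≡ c + c · (y · 0ℚ) + y · y · (0ℚ · 0ℚ - 0ℚ) + y · y · y · 0ℚ
    base = solve-∀ ring
  ∏-expand {y} {f} (suc n) y∈ f∈ with ∏-expand {y} {f} n y∈ (λ j j<n → f∈ j (ℕₚ.m<n⇒m<1+n j<n))
  ... | R , R∈ , eq = R′ , R′∈ , (begin
      2ℚ · (Π · (1ℚ + y · f n))                ≡⟨ sym (ℚₚ.*-assoc 2ℚ Π (1ℚ + y · f n)) ⟩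
      2ℚ · Π · (1ℚ + y · f n)                  ≡⟨ cong (_· (1ℚ + y · f n)) eq ⟩
      (2ℚ + 2ℚ · (y · τ₁) + y · y · (τ₁ · τ₁ - τ₂) + y · y · y · R) · (1ℚ + y · f n)
                                               ≡⟨ cong (λ c → (c + c · (y · τ₁) + y · y · (τ₁ · τ₁ - τ₂) + y · y · y · R) · (1ℚ + y · f n)) (ι-suc 1) ⟩
      (1ℚ + 1ℚ + (1ℚ + 1ℚ) · (y · τ₁) + y · y · (τ₁ · τ₁ - τ₂) + y · y · y · R) · (1ℚ + y · f n)
                                               ≡⟨ step y τ₁ τ₂ (f n) R ⟩
      1ℚ + 1ℚ + (1ℚ + 1ℚ) · (y · (τ₁ + f n)) + y · y · ((τ₁ + f n) · (τ₁ + f n) - (τ₂ + f n · f n)) + y · y · y · R′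
                                               ≡⟨ cong (λ c → c + c · (y · (τ₁ + f n)) + y · y · ((τ₁ + f n) · (τ₁ + f n) - (τ₂ + f n · f n)) + y · y · y · R′) (sym (ι-suc 1)) ⟩
      2ℚ + 2ℚ · (y · (τ₁ + f n)) + y · y · ((τ₁ + f n) · (τ₁ + f n) - (τ₂ + f n · f n)) + y · y · y · R′ ∎)
    where
    Π = ∏ (λ j → 1ℚ + y · f j) n
    τ₁ = ∑ f n
    τ₂ = ∑ (λ j → f j · f j) n
    R′ = R + f n · (τ₁ · τ₁ - τ₂) + y · (f n · R)
    fn∈ : f n ∈p^ 0
    fn∈ = f∈ n ℕₚ.≤-refl
    τ₁∈ : τ₁ ∈p^ 0
    τ₁∈ = ∑∈p^ n λ j j<n → f∈ j (ℕₚ.m<n⇒m<1+n j<n)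
    τ₂∈ : τ₂ ∈p^ 0
    τ₂∈ = ∑∈p^ n λ j j<n → ∈p^-· (f∈ j (ℕₚ.m<n⇒m<1+n j<n)) (f∈ j (ℕₚ.m<n⇒m<1+n j<n))
    R′∈ : R′ ∈p^ 0
    R′∈ = ∈p^-+ (∈p^-+ R∈ (∈p^-· fn∈ (∈p^-- (∈p^-· τ₁∈ τ₁∈) τ₂∈))) (∈p^-· y∈ (∈p^-· fn∈ R∈))
    step : ∀ y a b f R → (1ℚ + 1ℚ + (1ℚ + 1ℚ) · (y · a) + y · y · (a · a - b) + y · y · y · R) · (1ℚ + y · f) ≡
      1ℚ + 1ℚ + (1ℚ + 1ℚ) · (y · (a + f)) + y · y · ((a + f) · (a + f) - (b + f · f)) + y · y · y · (R + f · (a · a - b) + y · (f · R))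
    step = solve-∀ ring

  module _ (m : ℕ) where

    M y c : ℚ
    M = ι m · π
    c = ι m · ι m + ι m
    y = c · (π · π)

    M∈p^1 : M ∈p^ 1
    M∈p^1 = ∈p^-· (ι∈p^0 m) p∈p^1

    c∈p^0 : c ∈p^ 0
    c∈p^0 = ∈p^-+ (∈p^-· (ι∈p^0 m) (ι∈p^0 m)) (ι∈p^0 m)

    y∈p^2 : y ∈p^ 2
    y∈p^2 = ∈p^-· c∈p^0 (∈p^-· p∈p^1 p∈p^1)

    block≡∏ : block m ≡ ∏ (λ j → M + x j) q
    block≡∏ = ∏-cong q λ j _ → trans (ι-+ (m ℕ.* p) (suc j)) (cong (_+ x j) (ι-· m p))

    block-square : block m · block m ≡ a₀ · a₀ · ∏ (λ j → 1ℚ + y · s j) q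
    block-square = begin
      block m · block m                                              ≡⟨ cong₂ _·_ block≡∏ (trans block≡∏ (sym (∏-reverse (λ j → M + x j) q))) ⟩
      ∏ (λ j → M + x j) q · ∏ (λ j → M + x (q ∸ suc j)) q            ≡⟨ sym (∏-· (λ j → M + x j) (λ j → M + x (q ∸ suc j)) q) ⟩
      ∏ (λ j → (M + x j) · (M + x (q ∸ suc j))) q                    ≡⟨ ∏-cong q pair ⟩
      ∏ (λ j → x j · x (q ∸ suc j) · (1ℚ + y · s j)) q               ≡⟨ ∏-· (λ j → x j · x (q ∸ suc j)) (λ j → 1ℚ + y · s j) q ⟩
      ∏ (λ j → x j · x (q ∸ suc j)) q · E                            ≡⟨ cong (_· E) (trans (∏-· x (λ j → x (q ∸ suc j)) q) (cong (a₀ ·_) (∏-reverse x q))) ⟩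
      a₀ · a₀ · E                                                    ∎
      where
      E = ∏ (λ j → 1ℚ + y · s j) q
      -- The factor `1ℚ · 1ℚ` is a placeholder: `pair` replaces it by `(x t) · (x′ t′)`, which lets
      -- `x x′` be factored out.
      expand : ∀ m x x′ → (m · (x + x′) + x) · (m · (x + x′) + x′) ≡ x · x′ + (m · m + m) · ((x + x′) · (x + x′)) · (1ℚ · 1ℚ)
      expand = solve-∀ ring
      collect : ∀ y x x′ t t′ → x · x′ + y · (x · t · (x′ · t′)) ≡ x · x′ · (1ℚ + y · (t · t′))
      collect = solve-∀ ring
      pair : ∀ j → j < q → (M + x j) · (M + x (q ∸ suc j)) ≡ x j · x (q ∸ suc j) · (1ℚ + y · s j)
      pair j j<q = begin
        (ι m · π + x j) · (ι m · π + x′)                                            ≡⟨ cong (λ a → (ι m · a + x j) · (ι m · a + x′)) (sym (x+x′≡π j j<q)) ⟩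
        (ι m · (x j + x′) + x j) · (ι m · (x j + x′) + x′)                          ≡⟨ expand (ι m) (x j) x′ ⟩
        x j · x′ + c · ((x j + x′) · (x j + x′)) · (1ℚ · 1ℚ)                        ≡⟨ cong₂ (λ a b → x j · x′ + c · (a · a) · b) (x+x′≡π j j<q) (sym (cong₂ _·_ (x·t≡1 j) (x·t≡1 (q ∸ suc j)))) ⟩
        x j · x′ + y · (x j · t j · (x′ · t′ j))                                    ≡⟨ collect y (x j) x′ (t j) (t′ j) ⟩
        x j · x′ · (1ℚ + y · s j)                                                   ∎
        where x′ = x (q ∸ suc j)

    v W : ℚ
    v = c · g
    W = a₀ · (1ℚ + v)

    v∈p^3 : v ∈p^ 3
    v∈p^3 = ∈p^-· c∈p^0 g∈p^3

    -- The linear term is exact: `y σ₁ = c p² σ₁ = 2 c p H = 2 v`. In the quadratic term `y²`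
    -- contributes `p⁴`, and `σ₁² - σ₂` the fifth power; the cubic term lies in `p⁶`.
    ∏≡1+2v : ∏ (λ j → 1ℚ + y · s j) q - (1ℚ + 2ℚ · v) ∈p^ 5
    ∏≡1+2v = cancel-unit 2-unit (∈p^-resp (sym main) (∈p^-+
          (∈p^-· (∈p^-· y∈p^2 y∈p^2) (∈p^-- (∈p^-drop 1 (∈p^-· σ₁∈p^1 σ₁∈p^1)) σ₂∈p^1))
          (∈p^-drop 1 (∈p^-· (∈p^-· (∈p^-· y∈p^2 y∈p^2) y∈p^2) (proj₁ (proj₂ expansion))))))
      where
      Π = ∏ (λ j → 1ℚ + y · s j) q
      expansion = ∏-expand {y} {s} q (∈p^-drop 2 y∈p^2) s∈p^0
      R = proj₁ expansion
      yσ₁≡2v : y · σ₁ ≡ 2ℚ · v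
      yσ₁≡2v = begin
        c · (π · π) · σ₁          ≡⟨ regroup₁ c π σ₁ ⟩
        c · π · (π · σ₁)          ≡⟨ cong (c · π ·_) (sym 2H≡πσ₁) ⟩
        c · π · (2ℚ · H)          ≡⟨ regroup₂ c π 2ℚ H ⟩
        2ℚ · (c · (π · H))        ∎
        where
        regroup₁ : ∀ c p s → c · (p · p) · s ≡ c · p · (p · s)
        regroup₁ = solve-∀ ring
        regroup₂ : ∀ c p t h → c · p · (t · h) ≡ t · (c · (p · h))
        regroup₂ = solve-∀ ring
      distribute : ∀ t P v → t · (P - (1ℚ + v)) ≡ t · P - (t + t · v)
      distribute = solve-∀ ring
      subtract : ∀ t u a b → t + u + a + b - (t + u) ≡ a + b
      subtract = solve-∀ ring
      main : 2ℚ · (Π - (1ℚ + 2ℚ · v)) ≡ y · y · (σ₁ · σ₁ - σ₂) + y · y · y · R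
      main = begin
        2ℚ · (Π - (1ℚ + 2ℚ · v))            ≡⟨ distribute 2ℚ Π (2ℚ · v) ⟩
        2ℚ · Π - (2ℚ + 2ℚ · (2ℚ · v))       ≡⟨ cong₂ (λ a b → a - (2ℚ + 2ℚ · b)) (proj₂ (proj₂ expansion)) (sym yσ₁≡2v) ⟩
        2ℚ + 2ℚ · (y · σ₁) + y · y · (σ₁ · σ₁ - σ₂) + y · y · y · R - (2ℚ + 2ℚ · (y · σ₁))
                                            ≡⟨ subtract 2ℚ (2ℚ · (y · σ₁)) (y · y · (σ₁ · σ₁ - σ₂)) (y · y · y · R) ⟩
        y · y · (σ₁ · σ₁ - σ₂) + y · y · y · R ∎

    a₀∈p^0 : a₀ ∈p^ 0
    a₀∈p^0 = ∏∈p^0 q λ j _ → x∈p^0 j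

    block∈p^0 : block m ∈p^ 0
    block∈p^0 = ∏∈p^0 q λ j _ → ι∈p^0 (m ℕ.* p ℕ.+ suc j)

    block≡a₀ : block m - a₀ ∈p^ 1
    block≡a₀ = ∈p^-resp (cong (_- a₀) (sym block≡∏)) (∏-cong-mod q
      (λ j _ → ∈p^-+ (∈p^-drop 1 M∈p^1) (x∈p^0 j)) (λ j _ → x∈p^0 j)
      (λ j _ → ∈p^-resp (difference M (x j)) M∈p^1))
      where
      difference : ∀ a b → a ≡ a + b - b
      difference = solve-∀ ring

    -- Since `v²` lies in `p⁶`, `∏≡1+2v` says that the squares of `block m` and `W` agree. As
    -- `block m ≡ a₀` modulo `p`, the factor `block m + W` is `2 a₀` plus a multiple of `p`; this
    -- selects the sign of the root.
    block≡W : block m - W ∈p^ 5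
    block≡W = cancel-near-unit 5 (unit-· 2-unit (unit-∏ q λ j j<q → unit-ι (suc j) (∤-suc j<q)))
      (∈p^-+ block≡a₀ (∈p^-· a₀∈p^0 (∈p^-drop 2 v∈p^3)))
      (∈p^-- block∈p^0 (∈p^-· a₀∈p^0 (∈p^-+ (ι∈p^0 1) (∈p^-drop 3 v∈p^3))))
      (∈p^-resp eq (∈p^-· (∈p^-· a₀∈p^0 a₀∈p^0) (∈p^-- ∏≡1+2v (∈p^-drop 1 (∈p^-· v∈p^3 v∈p^3)))))
      where
      Π = ∏ (λ j → 1ℚ + y · s j) q
      distribute : ∀ A P v u → A · A · (P - (1ℚ + u) - v · v) ≡ A · A · P - A · A · (1ℚ + u + v · v)
      distribute = solve-∀ ring
      factor : ∀ B A v → B · B - A · A · (1ℚ + (v + v) + v · v) ≡ (B - A · (1ℚ + v)) · (A + A + (B - A + A · v))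
      factor = solve-∀ ring
      eq : a₀ · a₀ · (Π - (1ℚ + 2ℚ · v) - v · v) ≡ (block m - W) · (2ℚ · a₀ + (block m - a₀ + a₀ · v))
      eq = begin
        a₀ · a₀ · (Π - (1ℚ + 2ℚ · v) - v · v)                       ≡⟨ distribute a₀ Π v (2ℚ · v) ⟩
        a₀ · a₀ · Π - a₀ · a₀ · (1ℚ + 2ℚ · v + v · v)               ≡⟨ cong₂ (λ a b → a - a₀ · a₀ · (1ℚ + b + v · v)) (sym block-square) (2·-double v) ⟩
        block m · block m - a₀ · a₀ · (1ℚ + (v + v) + v · v)        ≡⟨ factor (block m) a₀ v ⟩
        (block m - W) · (a₀ + a₀ + (block m - a₀ + a₀ · v))         ≡⟨ cong (λ a → (block m - W) · (a + (block m - a₀ + a₀ · v))) (sym (2·-double a₀)) ⟩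
        (block m - W) · (2ℚ · a₀ + (block m - a₀ + a₀ · v))         ∎

  -- Binomial ratios modulo `p⁵`.

  block-unit : ∀ m → Unit (block m)
  block-unit m = unit-∏ q λ j j<q → unit-ι (m ℕ.* p ℕ.+ suc j) λ p∣ →
    ∤-suc j<q (∣.∣m+n∣m⇒∣n p∣ (∣.n∣m*n m))

  blocks-unit : ∀ n → Unit (blocks n)
  blocks-unit n = unit-∏ n λ m _ → block-unit m

  blocks∈p^0 : ∀ n → blocks n ∈p^ 0
  blocks∈p^0 n = ∏∈p^0 n λ m _ → block∈p^0 m

  oblongSum∈p^0 : ∀ n → oblongSum n ∈p^ 0
  oblongSum∈p^0 n = ∑∈p^ n λ m _ → c∈p^0 m

  a₀^∈p^0 : ∀ n → a₀ ^ℚ n ∈p^ 0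
  a₀^∈p^0 = ^ℚ∈p^0 (a₀∈p^0 0)

  -- The factors `1 + c g` multiply by adding their linear coefficients, because `g²` lies in `p⁶`.
  blocks-mod : ∀ n → blocks n - a₀ ^ℚ n · (1ℚ + oblongSum n · g) ∈p^ 5
  blocks-mod zero    = ∈p^-resp (collapse g) (0∈p^ 5)
    where
    collapse : ∀ g → 0ℚ ≡ 1ℚ - 1ℚ · (1ℚ + 0ℚ · g)
    collapse = solve-∀ ring
  blocks-mod (suc n) = ∈p^-resp (regroup (blocks n) (block n) (a₀ ^ℚ n) a₀ (oblongSum n) (c n) g)
    (∈p^-+ (∈p^-+ (∈p^-· (block∈p^0 n) (blocks-mod n))
                  (∈p^-· (∈p^-· (a₀^∈p^0 n) (∈p^-+ (ι∈p^0 1) (∈p^-drop 3 (∈p^-· (oblongSum∈p^0 n) g∈p^3)))) (block≡W n)))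
           (∈p^-drop 1 (∈p^-· (∈p^-· (∈p^-· (∈p^-· (a₀∈p^0 0) (a₀^∈p^0 n)) (∈p^-· (oblongSum∈p^0 n) (c∈p^0 n))) g∈p^3) g∈p^3)))
    where
    regroup : ∀ Q B b a T c g →
      B · (Q - b · (1ℚ + T · g)) + b · (1ℚ + T · g) · (B - a · (1ℚ + c · g)) + a · b · (T · c) · g · g ≡
      Q · B - a · b · (1ℚ + (T + c) · g)
    regroup = solve-∀ ring

  -- After multiplication by the unit `Qr · Qs` the powers of `a₀` agree, and the coefficients of
  -- `g` match by `oblongSum-+`. What remains is the three block errors and a multiple of `g²`.
  binomRatio-mod : ∀ n r (r≤n : r ≤ n) →
    binomRatio p n r r≤n - (1ℚ + ι (n ℕ.* r ℕ.* (n ∸ r)) · g) ∈p^ 5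
  binomRatio-mod n r r≤n = cancel-unit (unit-· (blocks-unit r) (blocks-unit s′)) (∈p^-resp (sym eq)
    (∈p^-- (∈p^-- δₙ∈ (∈p^-· 1+νg∈ (∈p^-+ (∈p^-· (blocks∈p^0 s′) (blocks-mod r)) (∈p^-· (∈p^-· (a₀^∈p^0 r) (1+Tg∈ r)) (blocks-mod s′)))))
           (∈p^-drop 1 (∈p^-· (∈p^-· (∈p^-· (∈p^-· (a₀^∈p^0 r) (a₀^∈p^0 s′)) rest∈) g∈p^3) g∈p^3))))
    where
    s′ = n ∸ r
    ν ρ a b Tr Ts Qr Qs Qn : ℚ
    ν  = ι (n ℕ.* r ℕ.* s′)
    ρ  = binomRatio p n r r≤n
    a  = a₀ ^ℚ r
    b  = a₀ ^ℚ s′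
    Tr = oblongSum r
    Ts = oblongSum s′
    Qr = blocks r
    Qs = blocks s′
    Qn = blocks n

    n≡r+s : r ℕ.+ s′ ≡ n
    n≡r+s = ℕₚ.m+[n∸m]≡n r≤n

    Tn : oblongSum n ≡ Tr + Ts + ν
    Tn = begin
      oblongSum n                                  ≡⟨ cong oblongSum (sym n≡r+s) ⟩
      oblongSum (r ℕ.+ s′)                         ≡⟨ oblongSum-+ r s′ ⟩
      Tr + Ts + ι (r ℕ.+ s′) · ι r · ι s′          ≡⟨ cong (λ k → Tr + Ts + ι k · ι r · ι s′) n≡r+s ⟩
      Tr + Ts + ι n · ι r · ι s′                   ≡⟨ cong (λ u → Tr + Ts + u · ι s′) (sym (ι-· n r)) ⟩
      Tr + Ts + ι (n ℕ.* r) · ι s′                 ≡⟨ cong (λ u → Tr + Ts + u) (sym (ι-· (n ℕ.* r) s′)) ⟩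
      Tr + Ts + ν                                  ∎

    δₙ∈ : Qn - a · b · (1ℚ + (Tr + Ts + ν) · g) ∈p^ 5
    δₙ∈ = ∈p^-resp (cong₂ (λ u T → Qn - u · (1ℚ + T · g))
      (trans (cong (a₀ ^ℚ_) (sym n≡r+s)) (^ℚ-+ a₀ r s′)) Tn) (blocks-mod n)

    1+Tg∈ : ∀ n → 1ℚ + oblongSum n · g ∈p^ 0
    1+Tg∈ n = ∈p^-+ (ι∈p^0 1) (∈p^-drop 3 (∈p^-· (oblongSum∈p^0 n) g∈p^3))

    1+νg∈ : 1ℚ + ν · g ∈p^ 0
    1+νg∈ = ∈p^-+ (ι∈p^0 1) (∈p^-drop 3 (∈p^-· (ι∈p^0 (n ℕ.* r ℕ.* s′)) g∈p^3))

    rest∈ : Tr · Ts + ν · (Tr + Ts + Tr · Ts · g) ∈p^ 0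
    rest∈ = ∈p^-+ TrTs∈ (∈p^-· (ι∈p^0 (n ℕ.* r ℕ.* s′))
      (∈p^-+ (∈p^-+ (oblongSum∈p^0 r) (oblongSum∈p^0 s′)) (∈p^-drop 3 (∈p^-· TrTs∈ g∈p^3))))
      where
      TrTs∈ : Tr · Ts ∈p^ 0
      TrTs∈ = ∈p^-· (oblongSum∈p^0 r) (oblongSum∈p^0 s′)

    distribute : ∀ R S ρ w → R · S · (ρ - w) ≡ ρ · (R · S) - w · (R · S)
    distribute = solve-∀ ring

    expand : ∀ Qn Qr Qs a b Tr Ts ν g → Qn - (1ℚ + ν · g) · (Qr · Qs) ≡
      Qn - a · b · (1ℚ + (Tr + Ts + ν) · g)
      - (1ℚ + ν · g) · (Qs · (Qr - a · (1ℚ + Tr · g)) + a · (1ℚ + Tr · g) · (Qs - b · (1ℚ + Ts · g)))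
      - a · b · (Tr · Ts + ν · (Tr + Ts + Tr · Ts · g)) · g · g
    expand = solve-∀ ring

    eq : Qr · Qs · (ρ - (1ℚ + ν · g)) ≡
      Qn - a · b · (1ℚ + (Tr + Ts + ν) · g)
      - (1ℚ + ν · g) · (Qs · (Qr - a · (1ℚ + Tr · g)) + a · (1ℚ + Tr · g) · (Qs - b · (1ℚ + Ts · g)))
      - a · b · (Tr · Ts + ν · (Tr + Ts + Tr · Ts · g)) · g · g
    eq = begin
      Qr · Qs · (ρ - (1ℚ + ν · g))                   ≡⟨ distribute Qr Qs ρ (1ℚ + ν · g) ⟩
      ρ · (Qr · Qs) - (1ℚ + ν · g) · (Qr · Qs)       ≡⟨ cong (_- (1ℚ + ν · g) · (Qr · Qs)) (binomRatio-blocks n r r≤n) ⟩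
      Qn - (1ℚ + ν · g) · (Qr · Qs)                  ≡⟨ expand Qn Qr Qs a b Tr Ts ν g ⟩
      _                                              ∎

  wp³≡g : ∀ w → w - harmonicOverSq p {{prime⇒nonZero pp}} ∈p^ 2 → w · ι (p ^ 3) - g ∈p^ 5
  wp³≡g w w∈ = ∈p^-resp (begin
      ι (p ^ 3) · (w - H · r²)                       ≡⟨ cong (_· (w - H · r²)) (ι-· p (p ^ 2)) ⟩
      π · ι (p ^ 2) · (w - H · r²)                   ≡⟨ regroup π (ι (p ^ 2)) w H r² ⟩
      w · (π · ι (p ^ 2)) - π · H · (ι (p ^ 2) · r²) ≡⟨ cong₂ (λ a b → w · a - g · b) (sym (ι-· p (p ^ 2))) (recip (p ^ 2)) ⟩
      w · ι (p ^ 3) - g · 1ℚ                         ≡⟨ cong (λ a → w · ι (p ^ 3) - a) (ℚₚ.*-identityʳ g) ⟩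
      w · ι (p ^ 3) - g                              ∎)
    (∈p^-· (p^∈p^ 3) w∈)
    where
    instance
      p²≢0 : NonZero (p ^ 2)
      p²≢0 = ℕₚ.m^n≢0 p 2
    r² = (+ 1) / (p ^ 2)
    regroup : ∀ p p² w h r → p · p² · (w - h · r) ≡ w · (p · p²) - p · h · (p² · r)
    regroup = solve-∀ ring

  binomRatio-mod-p⁵ : ∀ w → w - harmonicOverSq p {{prime⇒nonZero pp}} ∈p^ 2 → ∀ n r (r≤n : r ≤ n) →
    binomRatio p n r r≤n - (1ℚ + w · ι (n ℕ.* r ℕ.* (n ∸ r) ℕ.* p ^ 3)) ∈p^ 5
  binomRatio-mod-p⁵ w w∈ n r r≤n = ∈p^-resp (trans
      (regroup ρ ν g w (ι (p ^ 3)))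
      (cong (λ a → ρ - (1ℚ + w · a)) (sym (ι-· (n ℕ.* r ℕ.* (n ∸ r)) (p ^ 3)))))
    (∈p^-- (binomRatio-mod n r r≤n) (∈p^-· (ι∈p^0 (n ℕ.* r ℕ.* (n ∸ r))) (wp³≡g w w∈)))
    where
    ρ ν : ℚ
    ρ = binomRatio p n r r≤n
    ν = ι (n ℕ.* r ℕ.* (n ∸ r))
    regroup : ∀ ρ ν g w p³ → ρ - (1ℚ + ν · g) - ν · (w · p³ - g) ≡ ρ - (1ℚ + w · (ν · p³))
    regroup = solve-∀ ring

  binomRatio-mod-p⁴⇒g∈p^4 : (∀ n r (r≤n : r ≤ n) → binomRatio p n r r≤n - 1ℚ ∈p^ 4) → g ∈p^ 4
  -- For `n = 2`, `r = 1` the coefficient `n r (n - r)` is the unit `2`, so this single instance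
  -- recovers `g`.
  binomRatio-mod-p⁴⇒g∈p^4 ρ≡1 = cancel-unit 2-unit (∈p^-resp (isolate (binomRatio p 2 1 1≤2) (2ℚ · g))
    (∈p^-- (ρ≡1 2 1 1≤2) (∈p^-drop 1 (binomRatio-mod 2 1 1≤2))))
    where
    1≤2 : 1 ≤ 2
    1≤2 = s≤s z≤n
    isolate : ∀ ρ u → ρ - 1ℚ - (ρ - (1ℚ + u)) ≡ u
    isolate = solve-∀ ring

  g∈p^4⇒binomRatio-mod-p⁴ : g ∈p^ 4 → ∀ n r (r≤n : r ≤ n) → binomRatio p n r r≤n - 1ℚ ∈p^ 4
  g∈p^4⇒binomRatio-mod-p⁴ g∈ n r r≤n = ∈p^-resp (regroup (binomRatio p n r r≤n) (ν · g))
    (∈p^-+ (∈p^-drop 1 (binomRatio-mod n r r≤n)) (∈p^-· (ι∈p^0 (n ℕ.* r ℕ.* (n ∸ r))) g∈))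
    where
    ν = ι (n ℕ.* r ℕ.* (n ∸ r))
    regroup : ∀ ρ u → ρ - (1ℚ + u) + u ≡ ρ - 1ℚ
    regroup = solve-∀ ring

  -- The criterion in terms of the Bernoulli number of index `p - 3`.

  k : ℕ
  k = q ∸ 3

  3+k≡q : 3 ℕ.+ k ≡ q
  3+k≡q = ℕₚ.m+[n∸m]≡n (ℕₚ.≤-trans (ℕₚ.m≤m+n 3 3) 6≤q)

  1+k<q : suc k < q
  1+k<q = subst (suc k <_) 3+k≡q (ℕₚ.m<n+m (suc k) {2} (s≤s z≤n))

  p∸3≡1+k : p ∸ 3 ≡ suc k
  p∸3≡1+k = trans (cong (_∸ 2) (sym 3+k≡q)) refl

  2<q : 2 < q
  2<q = ℕₚ.≤-trans (ℕₚ.m≤m+n 3 3) 6≤q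

  2σ+H₂∈p^2 : 2ℚ · T.σ 2 + T.S 2 ∈p^ 2
  2σ+H₂∈p^2 = T.leading {1} {1} 1 (λ i i<1 → Tσ∈p^1 i (ℕₚ.<-trans (s≤s i<1) 2<q)) (λ i i<1 → H∈p^1 i (ℕₚ.<-trans (s≤s i<1) 2<q))

  kσ+S∈p^2 : ι (suc k) · X.σ (suc k) + X.S (suc k) ∈p^ 2
  kσ+S∈p^2 = X.leading {1} {1} k (λ i i<k → Xσ∈p^1 i (ℕₚ.<-trans (s≤s i<k) 1+k<q)) (λ i i<k → S∈p^1 i (ℕₚ.<-trans (s≤s i<k) 1+k<q))

  -- Here `suc k = p - 3`, and reversal pairs indices with sum `p - 1`; this is how the Bernoulli
  -- index is tied to the inverse squares.
  Xσ≡b₀Tσ : X.σ (suc k) ≡ b₀ · T.σ 2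
  Xσ≡b₀Tσ = X≡b₀T (suc k) 2 (trans (ℕₚ.+-comm (suc k) 2) 3+k≡q)

  -- From `p H` in `p⁴` follows `H` in `p³`, and `2 H = p σ₁` leaves `σ₁` in `p²`. Divisibility by
  -- `p²` then passes through `T.S 2`, `T.σ 2`, `X.σ (suc k)` and `X.S (suc k)` to `p` times the
  -- Bernoulli number.
  g∈p^4⇒B∈p^1 : g ∈p^ 4 → bernoulli (suc k) ∈p^ 1
  g∈p^4⇒B∈p^1 g∈ = cancel-p (∈p^-resp (isolate (X.S (suc k)) (π · bernoulli (suc k))) (∈p^-- S∈ (S≡pB k 1+k<q)))
    where
    isolate : ∀ a b → a - (a - b) ≡ b
    isolate = solve-∀ ring
    σ₁∈ : σ₁ ∈p^ 2
    σ₁∈ = cancel-p (∈p^-resp 2H≡πσ₁ (∈p^-· (ι∈p^0 2) (cancel-p g∈)))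
    H₂∈ : T.S 2 ∈p^ 2
    H₂∈ = +-cancelʳ-mod (T.S 2) σ₁ H₂+σ₁∈p^2 σ₁∈
    Tσ∈ : T.σ 2 ∈p^ 2
    Tσ∈ = cancel-unit 2-unit (+-cancelʳ-mod (2ℚ · T.σ 2) (T.S 2) 2σ+H₂∈p^2 H₂∈)
    S∈ : X.S (suc k) ∈p^ 2
    S∈ = +-cancelˡ-mod (ι (suc k) · X.σ (suc k)) kσ+S∈p^2 (∈p^-· (ι∈p^0 (suc k))
      (∈p^-resp (sym Xσ≡b₀Tσ) (∈p^-· (∏∈p^0 q λ j _ → ∈p^-neg (x∈p^0 j)) Tσ∈)))

  -- The same chain backwards: its multipliers `suc k`, `b₀` and `2` are units, so each link can be
  -- reversed.
  B∈p^1⇒g∈p^4 : bernoulli (suc k) ∈p^ 1 → g ∈p^ 4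
  B∈p^1⇒g∈p^4 B∈ = ∈p^-· p∈p^1 (cancel-unit 2-unit (∈p^-resp (sym 2H≡πσ₁) (∈p^-· p∈p^1 σ₁∈)))
    where
    rejoin : ∀ a b → a - b + b ≡ a
    rejoin = solve-∀ ring
    S∈ : X.S (suc k) ∈p^ 2
    S∈ = ∈p^-resp (rejoin (X.S (suc k)) (π · bernoulli (suc k))) (∈p^-+ (S≡pB k 1+k<q) (∈p^-· p∈p^1 B∈))
    Tσ∈ : T.σ 2 ∈p^ 2
    Tσ∈ = cancel-unit b₀-unit (∈p^-resp Xσ≡b₀Tσ
      (cancel-ι (suc k) (∤-suc (ℕₚ.<⇒≤ 1+k<q)) (+-cancelʳ-mod (ι (suc k) · X.σ (suc k)) (X.S (suc k)) kσ+S∈p^2 S∈)))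
    H₂∈ : T.S 2 ∈p^ 2
    H₂∈ = +-cancelˡ-mod (2ℚ · T.σ 2) 2σ+H₂∈p^2 (∈p^-· (ι∈p^0 2) Tσ∈)
    σ₁∈ : σ₁ ∈p^ 2
    σ₁∈ = +-cancelˡ-mod (T.S 2) H₂+σ₁∈p^2 H₂∈

  toCong : ∀ {k d} → d ∈p^ k → Σ ℚ λ z → IsPIntegral p z × d ≡ ι (p ^ k) · z
  toCong (multiple z z∈ eq) = z , z∈ , eq

  fromCong : ∀ k {d} → (Σ ℚ λ z → IsPIntegral p z × d ≡ ι (p ^ k) · z) → d ∈p^ k
  fromCong k (z , z∈ , eq) = multiple z z∈ eq

  binomRatio-mod-p⁴⇔ : ((n r : ℕ) (r≤n : r ≤ n) → CongModPow p 4 (binomRatio p n r r≤n) 1ℚ) ⇔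
                       (p ∣ ∣ ↥ bernoulli (p ∸ 3) ∣)
  binomRatio-mod-p⁴⇔ = mk⇔
    (λ ρ≡1 → subst (λ i → p ∣ ∣ ↥ bernoulli i ∣) (sym p∸3≡1+k)
      (∈p^1⇒p∣numerator (g∈p^4⇒B∈p^1 (binomRatio-mod-p⁴⇒g∈p^4 λ n r r≤n → fromCong 4 (ρ≡1 n r r≤n)))))
    (λ p∣B n r r≤n → toCong (g∈p^4⇒binomRatio-mod-p⁴ (B∈p^1⇒g∈p^4
      (p∣numerator⇒∈p^1 (bernoulli∈p^0 (suc k) 1+k<q) (subst (λ i → p ∣ ∣ ↥ bernoulli i ∣) p∸3≡1+k p∣B))) n r r≤n))

theorem3p2 : (p : ℕ) → (pp : Prime p) → 7 ≤ p →
    ((w : ℤ) → + 0 ℤ.≤ w → w ℤ.< + (p ^ 2) →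
    CongModPow p 2 (ℤ→ℚ w) (harmonicOverSq p {{prime⇒nonZero pp}}) →
    (n r : ℕ) (h : r ≤ n) →
    CongModPow p 5 (binomRatio p n r h) (1ℚ + ℤ→ℚ w *ℚ ℕ→ℚ (n * r * (n ∸ r) * p ^ 3)))
    ×
    (((n r : ℕ) (h : r ≤ n) → CongModPow p 4 (binomRatio p n r h) 1ℚ)
    ⇔ (p ∣ ∣ ↥ bernoulli (p ∸ 3) ∣))
theorem3p2 (suc q) pp (s≤s 6≤q) =
  (λ w _ _ w≡ n r h → toCong (binomRatio-mod-p⁵ (ℤ→ℚ w) (fromCong 2 w≡) n r h)) , binomRatio-mod-p⁴⇔
  where open Binomial q pp 6≤q
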